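{- Let $(G_k)_{k\in\mathbb{N}}$ be a family of $2$-optimal small-set expanders, where $G_k=(L_k\sqcup R_k;E_k)$ is left-regular of degree $d_k$, and put $n_k:=|L_k|$, $m_k:=|R_k|$. Assume that the sequence $\frac{m_k^2}{n_k}$ is bounded and that $m_k\to\infty$. Then for all $s\in\mathbb{N}$ with $s\ge 3$ and all $c\in\mathbb{R}$ with $c>1$ there is an index $k^*\in\mathbb{N}$ such that, for every $k\ge k^*$, the graph $G_k$ contains a bipartite subgraph $A_k$ with parts $L(A_k)\sqcup R(A_k)$, $L(A_k)\subseteq L_k$, $R(A_k)\subseteq R_k$, satisfying: (1) $A_k$ is left-regular of degree $d_k$; (2) $|L(A_k)|\ge c\,m_k\ge c\,|R(A_k)|$; (3) $A_k$ is an $s$-optimal small-set expander.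
   Context: Graphs are finite and simple. A bipartite graph $G$ with parts $L\sqcup R$ is left-regular of degree $d$ if every vertex of $L$ has exactly $d$ incident edges. For $X\subseteq L$, $N(X)\subseteq R$ is the set of vertices adjacent to at least one vertex of $X$. For an integer $1\le t\le |L|$, $$\alpha_G(t):=\min\left\{\frac{|N(X)|}{|X|}: X\subseteq L,\ 0<|X|\le t\right\}.$$ A left-regular bipartite graph $G$ of degree $d$ is an $s$-optimal small-set expander (for an integer $s\le |L|$) if $\alpha_G(t)\ge (d-1)+\frac1t$ for every integer $t$ with $1\le t\le s$. -}

module Defs where

open import Data.Fin.Base using (Fin)
open import Data.Fin.Properties using (any?)
open import Data.Fin.Subset using (Subset; _∈_; _⊆_; ∣_∣; ⁅_⁆; inside; outside)
open import Data.Fin.Subset.Properties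
  using (_∈?_; _⊆?_; nonempty?; ∣⁅x⁆∣≡1; x∈⁅y⁆⇒x≡y; Empty-unique; ∣⊥∣≡0)
open import Data.Integer.Base using (+_)
open import Data.List.Base using (List; []; _∷_; _++_; map; mapMaybe)
import Data.List.Membership.Propositional as List
open import Data.List.Membership.Propositional.Properties using (∈-++⁺ˡ; ∈-++⁺ʳ; ∈-map⁺)
import Data.List.Relation.Unary.All as All
open import Data.List.Relation.Unary.Any as Any using (Any; here)
open import Data.List.Relation.Unary.Any.Properties using (map⁺; mapMaybe⁺)
import Data.Maybe.Base as Maybe
import Data.Maybe.Relation.Unary.Any as MAny
open import Data.Nat.Base as ℕ using (ℕ; zero; suc)
import Data.Nat.Properties as ℕ
open import Data.Product.Base using (∃; ∃-syntax; _×_; _,_; proj₁; proj₂)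
open import Data.Rational.Base as ℚ
  using (ℚ; 0ℚ; 1ℚ; _/_; _+_; _*_; _-_; _≤_; _<_; Positive; 1/_)
import Data.Rational.Properties as ℚ
open import Data.Vec.Base as Vec using (tabulate)
open import Relation.Binary.Bundles using (DecTotalOrder)
open import Relation.Binary.PropositionalEquality
open import Relation.Nullary.Decidable using (Dec; yes; no; does; dec⇒maybe; _×-dec_)
open import Relation.Nullary.Negation using (contradiction)

open import Data.List.Extrema (DecTotalOrder.totalOrder ℚ.≤-decTotalOrder)
   using (argmin; f[argmin]≤f[xs])

------------------------------------------------------------------------
-- Finite bipartite graphs

-- The parts are subsets of the label sets Fin a and Fin b, so that the
-- subgraphs of a graph live over the same labels as the graph itself.
-- There is an edge between u and v iff v ∈ Γ u.
record BipartiteGraph (a b : ℕ) : Set where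
  field
    L    : Subset a
    R    : Subset b
    Γ    : Fin a → Subset b
    edge : ∀ {u v} → v ∈ Γ u → u ∈ L × v ∈ R

open BipartiteGraph public using (L; R; Γ)

private
  variable
    a b : ℕ

record Subgraph (A G : BipartiteGraph a b) : Set where
  field
    L-⊆ : L A ⊆ L G
    R-⊆ : R A ⊆ R G
    Γ-⊆ : ∀ u → Γ A u ⊆ Γ G u

LeftRegular : BipartiteGraph a b → ℕ → Set
LeftRegular G d = ∀ u → u ∈ L G → ∣ Γ G u ∣ ≡ d

N : BipartiteGraph a b → Subset a → Subset b
N G X = tabulate λ v → does (any? λ u → u ∈? X ×-dec v ∈? Γ G u)

------------------------------------------------------------------------
-- Small-set expansion

IsSmall : BipartiteGraph a b → ℕ → Subset a → Set
IsSmall G t X = X ⊆ L G × 0 ℕ.< ∣ X ∣ × ∣ X ∣ ℕ.≤ t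

isSmall? : (G : BipartiteGraph a b) (t : ℕ) (X : Subset a) → Dec (IsSmall G t X)
isSmall? G t X = X ⊆? L G ×-dec 0 ℕ.<? ∣ X ∣ ×-dec ∣ X ∣ ℕ.≤? t

SmallSet : BipartiteGraph a b → ℕ → Set
SmallSet G t = ∃ (IsSmall G t)

ratio : (G : BipartiteGraph a b) (t : ℕ) → SmallSet G t → ℚ
ratio G t (X , _ , 0<∣X∣ , _) = _/_ (+ ∣ N G X ∣) ∣ X ∣ {{ℕ.>-nonZero 0<∣X∣}}

subsets : ∀ n → List (Subset n)
subsets zero    = Vec.[] ∷ []
subsets (suc n) =
  map (inside Vec.∷_) (subsets n) ++ map (outside Vec.∷_) (subsets n)

smallSets : (G : BipartiteGraph a b) (t : ℕ) → List (SmallSet G t)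
smallSets {a = a} G t =
  mapMaybe (λ X → Maybe.map (X ,_) (dec⇒maybe (isSmall? G t X))) (subsets a)

singleton : (G : BipartiteGraph a b) (t : ℕ) .{{_ : ℕ.NonZero t}} →
            t ℕ.≤ ∣ L G ∣ → SmallSet G t
singleton {a = a} G t t≤∣L∣ with nonempty? (L G)
... | yes (u , u∈L) =
  ⁅ u ⁆ ,
  (λ x∈⁅u⁆ → subst (_∈ L G) (sym (x∈⁅y⁆⇒x≡y u x∈⁅u⁆)) u∈L) ,
  ℕ.≤-reflexive (sym (∣⁅x⁆∣≡1 u)) ,
  ℕ.≤-trans (ℕ.≤-reflexive (∣⁅x⁆∣≡1 u)) (ℕ.>-nonZero⁻¹ t)
... | no empty =
  contradiction (ℕ.≤-trans (ℕ.>-nonZero⁻¹ t) t≤∣L∣)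
    (ℕ.≤⇒≯ (ℕ.≤-reflexive (trans (cong ∣_∣ (Empty-unique empty)) (∣⊥∣≡0 a))))

minimiser : (G : BipartiteGraph a b) (t : ℕ) .{{_ : ℕ.NonZero t}} →
            t ℕ.≤ ∣ L G ∣ → SmallSet G t
minimiser G t t≤∣L∣ = argmin (ratio G t) (singleton G t t≤∣L∣) (smallSets G t)

∈-subsets : ∀ {n} (X : Subset n) → X List.∈ subsets n
∈-subsets Vec.[]            = here refl
∈-subsets (inside  Vec.∷ X) = ∈-++⁺ˡ (∈-map⁺ (inside Vec.∷_) (∈-subsets X))
∈-subsets (outside Vec.∷ X) =
  ∈-++⁺ʳ (map (inside Vec.∷_) (subsets _)) (∈-map⁺ (outside Vec.∷_) (∈-subsets X))

∈-smallSets : (G : BipartiteGraph a b) (t : ℕ) ((X , _) : SmallSet G t) →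
              Any (λ Y → proj₁ Y ≡ X) (smallSets G t)
∈-smallSets {a = a} G t (X , small) =
  mapMaybe⁺ _ (subsets a) (map⁺ (Any.map (λ {Y} → found (isSmall? G t Y)) (∈-subsets X)))
  where
  found : ∀ {Y} (p : Dec (IsSmall G t Y)) → X ≡ Y →
          MAny.Any (λ Z → proj₁ Z ≡ X) (Maybe.map (Y ,_) (dec⇒maybe p))
  found (yes _)      refl = MAny.just refl
  found (no ¬small) refl = contradiction small ¬small

ratio-cong : (G : BipartiteGraph a b) (t : ℕ) (X Y : SmallSet G t) →
             proj₁ X ≡ proj₁ Y → ratio G t X ≡ ratio G t Y
ratio-cong G t (X , _) (.X , _) refl = refl

-- α is opaque only to keep type checking fast; α-attained and α-minimal
-- characterise it as the minimum of the ratios.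
opaque
  α : (G : BipartiteGraph a b) (t : ℕ) .{{_ : ℕ.NonZero t}} → t ℕ.≤ ∣ L G ∣ → ℚ
  α G t t≤∣L∣ = ratio G t (minimiser G t t≤∣L∣)

  α-attained : (G : BipartiteGraph a b) (t : ℕ) .{{_ : ℕ.NonZero t}}
               (t≤∣L∣ : t ℕ.≤ ∣ L G ∣) →
               ∃[ X ] α G t t≤∣L∣ ≡ ratio G t X
  α-attained G t t≤∣L∣ = minimiser G t t≤∣L∣ , refl

  α-minimal : (G : BipartiteGraph a b) (t : ℕ) .{{_ : ℕ.NonZero t}}
              (t≤∣L∣ : t ℕ.≤ ∣ L G ∣) (X : SmallSet G t) →
              α G t t≤∣L∣ ≤ ratio G t X
  α-minimal G t t≤∣L∣ X =
    let Y , Y∈ , Y≡X = List.find {P = λ Y → proj₁ Y ≡ proj₁ X} (∈-smallSets G t X) in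
    subst (α G t t≤∣L∣ ≤_) (ratio-cong G t Y X Y≡X)
      (All.lookup {P = λ Z → α G t t≤∣L∣ ≤ ratio G t Z}
        (f[argmin]≤f[xs] {f = ratio G t} (singleton G t t≤∣L∣) (smallSets G t)) Y∈)

record OptimalExpander (G : BipartiteGraph a b) (d s : ℕ) : Set where
  field
    regular   : LeftRegular G d
    s≤∣L∣     : s ℕ.≤ ∣ L G ∣
    expansion : ∀ t .{{_ : ℕ.NonZero t}} (t≤s : t ℕ.≤ s) →
                (+ d / 1 - 1ℚ) + + 1 / t ≤ α G t (ℕ.≤-trans t≤s s≤∣L∣)

L-nonZero : {G : BipartiteGraph a b} {d s : ℕ} .{{_ : ℕ.NonZero s}} →
            OptimalExpander G d s → ℕ.NonZero ∣ L G ∣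
L-nonZero {s = s} opt =
  ℕ.>-nonZero (ℕ.≤-trans (ℕ.>-nonZero⁻¹ s) (OptimalExpander.s≤∣L∣ opt))

------------------------------------------------------------------------
-- Sequences

Bounded : (ℕ → ℚ) → Set
Bounded x = ∃[ B ] ∀ k → ℚ.∣ x k ∣ ≤ B

TendsToInfinity : (ℕ → ℕ) → Set
TendsToInfinity x = ∀ M → ∃[ K ] ∀ k → K ℕ.≤ k → M ℕ.≤ x k

------------------------------------------------------------------------
-- Real numbers, as Cauchy sequences of rationals

record ℝ : Set where
  field
    seq    : ℕ → ℚ
    cauchy : ∀ ε → 0ℚ < ε →
             ∃[ n ] ∀ i j → n ℕ.≤ i → n ℕ.≤ j → ℚ.∣ seq i - seq j ∣ < ε

open ℝ public using (seq)

infix 4 _≤ᴿ_ _<ᴿ_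

_≤ᴿ_ : ℝ → ℝ → Set
x ≤ᴿ y = ∀ ε → 0ℚ < ε → ∃[ n ] ∀ i → n ℕ.≤ i → seq x i ≤ seq y i + ε

_<ᴿ_ : ℝ → ℝ → Set
x <ᴿ y = ∃[ ε ] 0ℚ < ε × ∃[ n ] ∀ i → n ℕ.≤ i → seq x i + ε ≤ seq y i

fromℕ : ℕ → ℝ
fromℕ m = record
  { seq    = λ _ → + m / 1
  ; cauchy = λ ε 0<ε → 0 , λ _ _ _ _ →
      subst (_< ε) (sym (cong ℚ.∣_∣ (ℚ.+-inverseʳ (+ m / 1)))) 0<ε
  }

infixl 7 _·_

_·_ : ℝ → ℕ → ℝ
x · m = record { seq = λ i → seq x i * (+ m / 1) ; cauchy = scaled m }
  where
  scaled : ∀ m ε → 0ℚ < ε → ∃[ n ] ∀ i j → n ℕ.≤ i → n ℕ.≤ j →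
           ℚ.∣ seq x i * (+ m / 1) - seq x j * (+ m / 1) ∣ < ε
  scaled zero ε 0<ε = 0 , λ i j _ _ →
    subst (_< ε)
      (sym (cong₂ (λ p q → ℚ.∣ p - q ∣) (ℚ.*-zeroʳ (seq x i)) (ℚ.*-zeroʳ (seq x j))))
      0<ε
  scaled (suc m) ε 0<ε = n , bound
    where
    instance
      M>0 : Positive (+ suc m / 1)
      M>0 = ℚ.normalize-pos (suc m) 1
      M≠0 : ℚ.NonZero (+ suc m / 1)
      M≠0 = ℚ.pos⇒nonZero (+ suc m / 1)
    M = + suc m / 1
    instance
      1/M>0 : Positive (1/ M)
      1/M>0 = ℚ.1/pos⇒pos M
    δ = ε * 1/ M
    0<δ : 0ℚ < δ
    0<δ = subst (_< δ) (ℚ.*-zeroˡ (1/ M)) (ℚ.*-monoˡ-<-pos (1/ M) 0<ε)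
    n = proj₁ (ℝ.cauchy x δ 0<δ)
    bound : ∀ i j → n ℕ.≤ i → n ℕ.≤ j → ℚ.∣ seq x i * M - seq x j * M ∣ < ε
    bound i j n≤i n≤j = begin-strict
      ℚ.∣ seq x i * M - seq x j * M ∣       ≡⟨ cong (λ q → ℚ.∣ seq x i * M + q ∣) (ℚ.neg-distribˡ-* (seq x j) M) ⟩
      ℚ.∣ seq x i * M + ℚ.- seq x j * M ∣   ≡⟨ cong ℚ.∣_∣ (ℚ.*-distribʳ-+ M (seq x i) (ℚ.- seq x j)) ⟨
      ℚ.∣ (seq x i - seq x j) * M ∣         ≡⟨ ℚ.∣p*q∣≡∣p∣*∣q∣ (seq x i - seq x j) M ⟩
      ℚ.∣ seq x i - seq x j ∣ * ℚ.∣ M ∣     ≡⟨ cong (ℚ.∣ seq x i - seq x j ∣ *_) (ℚ.0≤p⇒∣p∣≡p (ℚ.<⇒≤ (ℚ.positive⁻¹ M))) ⟩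
      ℚ.∣ seq x i - seq x j ∣ * M           <⟨ ℚ.*-monoˡ-<-pos M (proj₂ (ℝ.cauchy x δ 0<δ) i j n≤i n≤j) ⟩
      ε * 1/ M * M                          ≡⟨ ℚ.*-assoc ε (1/ M) M ⟩
      ε * (1/ M * M)                        ≡⟨ cong (ε *_) (ℚ.*-inverseˡ M) ⟩
      ε * 1ℚ                                ≡⟨ ℚ.*-identityʳ ε ⟩
      ε                                     ∎
      where open ℚ.≤-Reasoning

{-# OPTIONS --safe #-}

-- A 2-optimal expander is a partial linear space: regard the left vertices as lines of d
-- points, two of which meet in at most one point.  Since m² ≤ B n, counting pairs
-- of points gives d ≤ B + 1, and for d ≤ 1 the graph itself will do.  For d ≥ 2
-- insert lines greedily, as long as
--   (i)  no two points of the new line are joined by a short walk along the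
--        earlier lines, and
--   (ii) no point of the new line already lies on D chosen lines.
-- A rejected line contains either two points at bounded distance, and there are
-- O(m) such pairs because of the degree bound, or a point of degree D, and double
-- counting leaves at most m / 2B of these, which meet at most m² / 2B lines.  So
-- while only C m lines are chosen and m is large, the n ≥ m² / B lines are not
-- exhausted.  Finally, by (i), each of t ≤ s chosen lines, inserted in order,
-- joins d distinct components of the point set, so t of them cover at least
-- (d - 1) t + 1 points.

module Submission where

open import Defs
open import Algebra.Properties.CommutativeSemigroup using (x∙yz≈y∙xz)
open import Data.Fin.Base using (Fin; zero; suc)
import Data.Fin.Properties as Fin
open import Data.Fin.Subset using (Subset; _∈_; ∣_∣; inside; outside; ⁅_⁆; _∪_; _∩_)
  renaming (_⊆_ to _⊆ˢ_)
open import Data.Fin.Subset.Properties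
  using (_∈?_; x∈⁅y⁆⇒x≡y; x∈⁅x⁆; ∣⁅x⁆∣≡1; x∈p∪q⁻; x∈p∪q⁺; x∈p∩q⁺; p⊆q⇒∣p∣≤∣q∣)
open import Data.Integer.Base as ℤ using (+_)
import Data.Integer.Properties as ℤ
import Data.Integer.Solver as ℤ
open import Data.List.Base
  using (List; []; _∷_; _++_; map; concatMap; filter; length; cartesianProduct)
open import Data.List.Properties using (length-map; length-++; filter-accept; filter-reject)
import Data.List.Membership.DecPropositional as DecMembership
import Data.List.Membership.Propositional as List
open import Data.List.Membership.Propositional.Properties
  using (∈-map⁺; ∈-map⁻; ∈-concatMap⁺; ∈-concatMap⁻; ∈-++⁺ˡ; ∈-++⁺ʳ; ∈-++⁻;
         ∈-filter⁺; ∈-filter⁻; ∈-cartesianProduct⁺)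
open import Data.List.Relation.Binary.Disjoint.Propositional using (Disjoint)
open import Data.List.Relation.Binary.Sublist.Propositional as Sublist using (_⊆_; []; _∷ʳ_; _∷_)
import Data.List.Relation.Binary.Sublist.Propositional.Properties as Sublist
open import Data.List.Relation.Unary.All as All using (All; []; _∷_)
open import Data.List.Relation.Unary.All.Properties as All using (¬Any⇒All¬; All¬⇒¬Any)
open import Data.List.Relation.Unary.AllPairs as AllPairs using ([]; _∷_)
import Data.List.Relation.Unary.AllPairs.Properties as AllPairs
open import Data.List.Relation.Unary.Any as Any using (Any; here; there; _─_)
import Data.List.Relation.Unary.Any.Properties as Any
open import Data.List.Relation.Unary.Unique.Propositional using (Unique)
import Data.List.Relation.Unary.Unique.Propositional.Properties as Unique
open import Data.Nat.Base as ℕ using (ℕ; zero; suc; _+_; _*_; _^_; _≤_; _<_; s≤s; z≤n)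
open import Data.Nat.ListAction using (sum)
import Data.Nat.Properties as ℕ
import Data.Nat.Solver as ℕ
open import Data.Product.Base using (∃-syntax; Σ-syntax; _×_; _,_; proj₁; proj₂)
open import Data.Rational.Base as ℚ using (ℚ; 0ℚ; 1ℚ; _/_; mkℚ)
import Data.Rational.Properties as ℚ
import Data.Rational.Unnormalised.Base as ℚᵘ
import Data.Rational.Unnormalised.Properties as ℚᵘ
open import Data.Sum.Base using (_⊎_; inj₁; inj₂; [_,_]′)
open import Data.Vec.Base using (tabulate; here; there) renaming ([] to []ᵛ; _∷_ to _∷ᵛ_)
open import Data.Vec.Properties using (lookup∘tabulate; []=⇒lookup; lookup⇒[]=)
open import Relation.Binary.PropositionalEquality
  using (_≡_; _≢_; refl; sym; trans; cong; cong₂; subst; subst₂; module ≡-Reasoning)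
open import Relation.Nullary using (¬_; ¬?; Dec; yes; no; does; contradiction; _×-dec_)
open import Relation.Nullary.Decidable using (dec-true)

-- Lists: matching and counting

remove : ∀ {A : Set} {P Q : A → Set} {ys} (p : Any P ys) → Any Q ys →
         (∃[ y ] P y × Q y) ⊎ Any Q (ys ─ p)
remove (here px)  (here qx) = inj₁ (_ , px , qx)
remove (here px)  (there q) = inj₂ q
remove (there p)  (here qx) = inj₂ (here qx)
remove (there p)  (there q) with remove p q
... | inj₁ r = inj₁ r
... | inj₂ r = inj₂ (there r)

length-─ : ∀ {A : Set} {P : A → Set} {ys} (p : Any P ys) → suc (length (ys ─ p)) ≡ length ys
length-─ (here px)                = refl
length-─ {ys = _ ∷ _ ∷ _} (there p) = cong suc (length-─ p)

-- Induction on `xs`: the partner of the head is deleted from `ys`. By functionality no later `x'`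
-- has the same partner, so each of them keeps its own.
pigeonhole : ∀ {A B : Set} {R : A → B → Set} {xs ys} →
             (∀ {x x' y} → R x y → R x' y → x ≡ x') →
             Unique xs → All (λ x → Any (R x) ys) xs → length xs ≤ length ys
pigeonhole functional []          []       = z≤n
pigeonhole {R = R} {ys = ys} functional (_∷_ {x} x# !xs) (p ∷ ps) =
  subst (_ ≤_) (length-─ p)
    (s≤s (pigeonhole functional !xs (All.zipWith step (x# , ps))))
  where
  step : ∀ {x'} → (x ≢ x') × Any (R x') ys → Any (R x') (ys ─ p)
  step (x≢x' , q) with remove p q
  ... | inj₁ (y , r , r') = contradiction (functional r r') x≢x'
  ... | inj₂ q'           = q'

Unique⇒length≤ : ∀ {A : Set} {xs ys : List A} → Unique xs →
                 (∀ {x} → x List.∈ xs → x List.∈ ys) → length xs ≤ length ys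
Unique⇒length≤ !xs xs⊆ys =
  pigeonhole (λ { refl refl → refl }) !xs (All.tabulate xs⊆ys)

∈-concatMap : ∀ {A B : Set} (f : A → List B) {xs x y} → x List.∈ xs → y List.∈ f x → y List.∈ concatMap f xs
∈-concatMap f x∈ y∈ = ∈-concatMap⁺ f (Any.map (λ { refl → y∈ }) x∈)

-- Injectivity is asked only on the entries of `xs`, because `rep` below separates the points of a
-- new line but not all points.
map-unique : ∀ {A B : Set} (f : A → B) {xs} →
             (∀ {x y} → x List.∈ xs → y List.∈ xs → x ≢ y → f x ≢ f y) →
             Unique xs → Unique (map f xs)
map-unique f inj []         = []
map-unique f inj (x# ∷ !xs) =
  ¬Any⇒All¬ _ (λ fx∈ → let y , y∈ , eq = ∈-map⁻ f fx∈ in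
    inj (here refl) (there y∈) (All.lookup x# y∈) eq)
  ∷ map-unique f (λ p q → inj (there p) (there q)) !xs

length-concatMap-≤ : ∀ {A B : Set} {f : A → List B} {k} → (∀ x → length (f x) ≤ k) →
                     ∀ xs → length (concatMap f xs) ≤ length xs * k
length-concatMap-≤ f≤k []       = z≤n
length-concatMap-≤ {f = f} f≤k (x ∷ xs) =
  subst (_≤ _) (sym (length-++ (f x))) (ℕ.+-mono-≤ (f≤k x) (length-concatMap-≤ f≤k xs))

length-concatMap-≥ : ∀ {A B : Set} {f : A → List B} {k xs} → All (λ x → k ≤ length (f x)) xs →
                     length xs * k ≤ length (concatMap f xs)
length-concatMap-≥ []       = z≤n
length-concatMap-≥ {f = f} (_∷_ {x} k≤f ps) =
  subst (_ ≤_) (sym (length-++ (f x))) (ℕ.+-mono-≤ k≤f (length-concatMap-≥ ps))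

length-cartesianProduct : ∀ {A B : Set} (xs : List A) (ys : List B) →
                          length (cartesianProduct xs ys) ≡ length xs * length ys
length-cartesianProduct []       ys = refl
length-cartesianProduct (x ∷ xs) ys =
  trans (length-++ (map (x ,_) ys))
    (cong₂ _+_ (length-map (x ,_) ys) (length-cartesianProduct xs ys))

sum-≥ : ∀ {A : Set} (f : A → ℕ) {k xs} → All (λ x → k ≤ f x) xs →
        length xs * k ≤ sum (map f xs)
sum-≥ f []       = z≤n
sum-≥ f (p ∷ ps) = ℕ.+-mono-≤ p (sum-≥ f ps)

-- Finite subsets

elements : ∀ {n} → Subset n → List (Fin n)
elements []ᵛ             = []
elements (inside  ∷ᵛ p) = zero ∷ map suc (elements p)
elements (outside ∷ᵛ p) = map suc (elements p)

length-elements : ∀ {n} (p : Subset n) → length (elements p) ≡ ∣ p ∣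
length-elements []ᵛ            = refl
length-elements (inside  ∷ᵛ p) = cong suc (trans (length-map suc (elements p)) (length-elements p))
length-elements (outside ∷ᵛ p) = trans (length-map suc (elements p)) (length-elements p)

∈-elements⁺ : ∀ {n} {p : Subset n} {x} → x ∈ p → x List.∈ elements p
∈-elements⁺ {p = inside  ∷ᵛ p} here      = here refl
∈-elements⁺ {p = inside  ∷ᵛ p} (there x) = there (∈-map⁺ suc (∈-elements⁺ x))
∈-elements⁺ {p = outside ∷ᵛ p} (there x) = ∈-map⁺ suc (∈-elements⁺ x)

∈-elements⁻ : ∀ {n} {p : Subset n} {x} → x List.∈ elements p → x ∈ p
∈-elements⁻ {p = inside  ∷ᵛ p} (here refl) = here
∈-elements⁻ {p = inside  ∷ᵛ p} (there x) with ∈-map⁻ suc x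
... | y , y∈ , refl = there (∈-elements⁻ y∈)
∈-elements⁻ {p = outside ∷ᵛ p} x with ∈-map⁻ suc x
... | y , y∈ , refl = there (∈-elements⁻ y∈)

elements-unique : ∀ {n} (p : Subset n) → Unique (elements p)
elements-unique []ᵛ            = []
elements-unique (inside  ∷ᵛ p) =
  ¬Any⇒All¬ _ zero∉ ∷ Unique.map⁺ Fin.suc-injective (elements-unique p)
  where
  zero∉ : ¬ zero List.∈ map suc (elements p)
  zero∉ z with ∈-map⁻ suc z
  ... | _ , _ , ()
elements-unique (outside ∷ᵛ p) = Unique.map⁺ Fin.suc-injective (elements-unique p)

Unique⇒length≤∣∣ : ∀ {n} {xs} {p : Subset n} → Unique xs →
                   (∀ {x} → x List.∈ xs → x ∈ p) → length xs ≤ ∣ p ∣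
Unique⇒length≤∣∣ {p = p} !xs xs⊆p =
  subst (_ ≤_) (length-elements p) (Unique⇒length≤ !xs (λ x → ∈-elements⁺ (xs⊆p x)))

∣∣≤length : ∀ {n} {xs} {p : Subset n} → (∀ {x} → x ∈ p → x List.∈ xs) → ∣ p ∣ ≤ length xs
∣∣≤length {p = p} p⊆xs =
  subst (_≤ _) (length-elements p)
    (Unique⇒length≤ (elements-unique p) (λ x → p⊆xs (∈-elements⁻ x)))

elements-nonempty : ∀ {n e} (p : Subset n) → ∣ p ∣ ≡ suc e →
                    ∃[ x ] ∃[ xs ] elements p ≡ x ∷ xs × length xs ≡ e
elements-nonempty p ∣p∣ with elements p | length-elements p
... | []     | 0≡  = contradiction (trans 0≡ ∣p∣) λ ()
... | x ∷ xs | len = x , xs , refl , ℕ.suc-injective (trans len ∣p∣)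

∣∪∣+∣∩∣ : ∀ {n} (p q : Subset n) → ∣ p ∪ q ∣ + ∣ p ∩ q ∣ ≡ ∣ p ∣ + ∣ q ∣
∣∪∣+∣∩∣ []ᵛ            []ᵛ            = refl
∣∪∣+∣∩∣ (inside  ∷ᵛ p) (inside  ∷ᵛ q) = cong suc (trans (ℕ.+-suc _ _) (trans (cong suc (∣∪∣+∣∩∣ p q)) (sym (ℕ.+-suc _ _))))
∣∪∣+∣∩∣ (inside  ∷ᵛ p) (outside ∷ᵛ q) = cong suc (∣∪∣+∣∩∣ p q)
∣∪∣+∣∩∣ (outside ∷ᵛ p) (inside  ∷ᵛ q) = trans (cong suc (∣∪∣+∣∩∣ p q)) (sym (ℕ.+-suc _ _))
∣∪∣+∣∩∣ (outside ∷ᵛ p) (outside ∷ᵛ q) = ∣∪∣+∣∩∣ p q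

module _ {n} {P : Fin n → Set} (P? : ∀ x → Dec (P x)) where

  -- Shaped like the body of `N`, so that the two membership lemmas apply to `N G X` by definition.
  comprehension : Subset n
  comprehension = tabulate λ x → does (P? x)

  ∈-comprehension⁺ : ∀ {x} → P x → x ∈ comprehension
  ∈-comprehension⁺ {x} px =
    lookup⇒[]= x comprehension (trans (lookup∘tabulate (λ x → does (P? x)) x) (dec-true (P? x) px))

  ∈-comprehension⁻ : ∀ {x} → x ∈ comprehension → P x
  ∈-comprehension⁻ {x} x∈
    with P? x | trans (sym (lookup∘tabulate (λ x → does (P? x)) x)) ([]=⇒lookup x∈)
  ... | yes px | _  = px
  ... | no _   | ()

-- Rational and real numbers

toℚᵘ-/ : ∀ p n .{{_ : ℕ.NonZero n}} → ℚ.toℚᵘ (p / n) ℚᵘ.≃ p ℚᵘ./ n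
toℚᵘ-/ p (suc n) = ℚ.toℚᵘ-fromℚᵘ (ℚᵘ.mkℚᵘ p n)

/-cancel-≤ : ∀ p q m n .{{_ : ℕ.NonZero m}} .{{_ : ℕ.NonZero n}} →
             p / m ℚ.≤ q / n → p ℤ.* + n ℤ.≤ q ℤ.* + m
/-cancel-≤ p q (suc m) (suc n) p≤q =
  ℚᵘ.drop-*≤* (ℚᵘ.≤-respʳ-≃ (toℚᵘ-/ q (suc n)) (ℚᵘ.≤-respˡ-≃ (toℚᵘ-/ p (suc m)) (ℚ.toℚᵘ-mono-≤ p≤q)))

/-mono-≤ : ∀ p q m n .{{_ : ℕ.NonZero m}} .{{_ : ℕ.NonZero n}} →
           p ℤ.* + n ℤ.≤ q ℤ.* + m → p / m ℚ.≤ q / n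
/-mono-≤ p q (suc m) (suc n) p≤q =
  ℚ.toℚᵘ-cancel-≤ (ℚᵘ.≤-respʳ-≃ (ℚᵘ.≃-sym (toℚᵘ-/ q (suc n)))
    (ℚᵘ.≤-respˡ-≃ (ℚᵘ.≃-sym (toℚᵘ-/ p (suc m))) (ℚᵘ.*≤* p≤q)))

-- The numerator of `(d - 1) + 1/t` over the denominator `t`; an integer, because `d` may be 0.
numerator : ℕ → ℕ → ℤ.ℤ
numerator d t = (+ d ℤ.- + 1) ℤ.* + t ℤ.+ + 1

expansion-bound : ∀ d t .{{_ : ℕ.NonZero t}} →
                  (+ d / 1 ℚ.- 1ℚ) ℚ.+ + 1 / t ≡ numerator d t / t
expansion-bound d t@(suc t-1) = ℚ.toℚᵘ-injective (begin
  ℚ.toℚᵘ ((+ d / 1 ℚ.- 1ℚ) ℚ.+ + 1 / t)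
    ≈⟨ ℚ.toℚᵘ-homo-+ (+ d / 1 ℚ.- 1ℚ) (+ 1 / t) ⟩
  ℚ.toℚᵘ (+ d / 1 ℚ.- 1ℚ) ℚᵘ.+ ℚ.toℚᵘ (+ 1 / t)
    ≈⟨ ℚᵘ.+-cong (ℚ.toℚᵘ-homo-+ (+ d / 1) (ℚ.- 1ℚ)) (toℚᵘ-/ (+ 1) t) ⟩
  (ℚ.toℚᵘ (+ d / 1) ℚᵘ.+ ℚ.toℚᵘ (ℚ.- 1ℚ)) ℚᵘ.+ + 1 ℚᵘ./ t
    ≈⟨ ℚᵘ.+-cong (ℚᵘ.+-cong (toℚᵘ-/ (+ d) 1) ℚᵘ.≃-refl) ℚᵘ.≃-refl ⟩
  (+ d ℚᵘ./ 1 ℚᵘ.+ ℚᵘ.- ℚᵘ.1ℚᵘ) ℚᵘ.+ + 1 ℚᵘ./ t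
    ≈⟨ ℚᵘ.*≡* (solve 2 (λ d t → ((d :* con (+ 1) :+ con (ℤ.- + 1) :* con (+ 1)) :* t :+ con (+ 1) :* con (+ 1)) :* t
                := ((d :- con (+ 1)) :* t :+ con (+ 1)) :* (con (+ 1) :* t)) refl (+ d) (+ t)) ⟩
  numerator d t ℚᵘ./ t
    ≈⟨ toℚᵘ-/ (numerator d t) t ⟨
  ℚ.toℚᵘ (numerator d t / t) ∎)
  where
  open ℚᵘ.≃-Reasoning
  open ℤ.+-*-Solver

-- Adding t k to both sides of the cleared inequality (d - 1 + 1/t) k t ≤ n t
-- removes the negative term, so that it becomes one between natural numbers.
cleared-left : ∀ d t k → numerator d t ℤ.* + k ℤ.+ + t ℤ.* + k ≡ + (k * (d * t + 1))
cleared-left d t k = trans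
  (solve 3 (λ d t k → (((d :- con (+ 1)) :* t :+ con (+ 1)) :* k) :+ t :* k
     := k :* (d :* t :+ con (+ 1))) refl (+ d) (+ t) (+ k))
  (sym (trans (ℤ.pos-* k (d * t + 1)) (cong (λ z → + k ℤ.* (z ℤ.+ + 1)) (ℤ.pos-* d t))))
  where open ℤ.+-*-Solver

cleared-right : ∀ t n k → + n ℤ.* + t ℤ.+ + t ℤ.* + k ≡ + (t * (n + k))
cleared-right t n k = trans
  (solve 3 (λ t n k → n :* t :+ t :* k := t :* (n :+ k)) refl (+ t) (+ n) (+ k))
  (sym (ℤ.pos-* t (n + k)))
  where open ℤ.+-*-Solver

expansion⇒ : ∀ d t n k .{{_ : ℕ.NonZero t}} .{{_ : ℕ.NonZero k}} →
             (+ d / 1 ℚ.- 1ℚ) ℚ.+ + 1 / t ℚ.≤ + n / k → k * (d * t + 1) ≤ t * (n + k)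
expansion⇒ d t n k le = ℤ.drop‿+≤+ (subst₂ ℤ._≤_ (cleared-left d t k) (cleared-right t n k)
  (ℤ.+-monoˡ-≤ (+ t ℤ.* + k)
    (/-cancel-≤ (numerator d t) (+ n) t k (subst (ℚ._≤ + n / k) (expansion-bound d t) le))))

⇒expansion : ∀ d t n k .{{_ : ℕ.NonZero t}} .{{_ : ℕ.NonZero k}} →
             k * (d * t + 1) ≤ t * (n + k) → (+ d / 1 ℚ.- 1ℚ) ℚ.+ + 1 / t ℚ.≤ + n / k
⇒expansion d t n k le = subst (ℚ._≤ + n / k) (sym (expansion-bound d t))
  (/-mono-≤ (numerator d t) (+ n) t k (subst₂ ℤ._≤_ (cancel (numerator d t ℤ.* + k) tk) (cancel (+ n ℤ.* + t) tk)
     (ℤ.+-monoˡ-≤ (ℤ.- tk)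
        (subst₂ ℤ._≤_ (sym (cleared-left d t k)) (sym (cleared-right t n k)) (ℤ.+≤+ le)))))
  where
  open ℤ.+-*-Solver
  tk = + t ℤ.* + k
  cancel : ∀ x y → x ℤ.+ y ℤ.- y ≡ x
  cancel = solve 2 (λ x y → x :+ y :- y := x) refl

p≤∣p∣ : ∀ p → p ℚ.≤ ℚ.∣ p ∣
p≤∣p∣ p@(mkℚ (+ _) _ _)      = ℚ.≤-refl
p≤∣p∣ p@(mkℚ ℤ.-[1+ _ ] _ _) = ℚ.≤-trans (ℚ.<⇒≤ (ℚ.negative⁻¹ p)) (ℚ.0≤∣p∣ p)

-- The denominator is at least 1, so the absolute value of the numerator is a bound.
natural-bound : ∀ q → ∃[ n ] q ℚ.≤ + n / 1
natural-bound q@(mkℚ p d-1 _) = ℤ.∣ p ∣ ,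
  subst (ℚ._≤ + ℤ.∣ p ∣ / 1) (ℚ.↥p/↧p≡p q) (/-mono-≤ p (+ ℤ.∣ p ∣) (suc d-1) 1
    (begin
      p ℤ.* + 1               ≡⟨ ℤ.*-identityʳ p ⟩
      p                       ≤⟨ ≤∣∣ p ⟩
      + ℤ.∣ p ∣               ≤⟨ ℤ.+≤+ (ℕ.m≤m*n ℤ.∣ p ∣ (suc d-1)) ⟩
      + (ℤ.∣ p ∣ * suc d-1)    ≡⟨ ℤ.pos-* ℤ.∣ p ∣ (suc d-1) ⟩
      + ℤ.∣ p ∣ ℤ.* + suc d-1 ∎))
  where
  open ℤ.≤-Reasoning
  ≤∣∣ : ∀ p → p ℤ.≤ + ℤ.∣ p ∣
  ≤∣∣ (+ n)       = ℤ.≤-refl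
  ≤∣∣ ℤ.-[1+ n ] = ℤ.-≤+

-- The successor makes the constant positive, so that `self-subexpander` can cancel it.
bounded⇒ : ∀ {B : ℚ} x n .{{_ : ℕ.NonZero n}} → ℚ.∣ + x / n ∣ ℚ.≤ B →
           x ≤ suc (proj₁ (natural-bound B)) * n
bounded⇒ {B} x n ∣∣≤B = ℕ.m≤n⇒m≤o+n n (ℤ.drop‿+≤+ (subst₂ ℤ._≤_ (ℤ.*-identityʳ (+ x)) (sym (ℤ.pos-* β n))
  (/-cancel-≤ (+ x) (+ β) n 1 (ℚ.≤-trans (p≤∣p∣ _) (ℚ.≤-trans ∣∣≤B (proj₂ (natural-bound B)))))))
  where
  β = proj₁ (natural-bound B)

-- From some index on, all terms of a Cauchy sequence are within 1 of a fixed term. The bound is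
-- written as a successor to be positive.
eventually-bounded : (c : ℝ) → ∃[ C ] ∃[ n ] ∀ i → n ≤ i → seq c i ℚ.≤ + suc C / 1
eventually-bounded c =
  let n , close = ℝ.cauchy c 1ℚ (ℚ.*<* (ℤ.+<+ (s≤s z≤n)))
      C , c≤C = natural-bound (seq c n ℚ.+ 1ℚ)
  in C , n , λ i n≤i → ℚ.≤-trans (below (seq c i) (seq c n) (close i n n≤i ℕ.≤-refl))
       (ℚ.≤-trans c≤C (/-mono-≤ (+ C) (+ suc C) 1 1 (ℤ.*-monoʳ-≤-nonNeg (+ 1) (ℤ.+≤+ (ℕ.n≤1+n C)))))
  where
  below : ∀ x y → ℚ.∣ x ℚ.- y ∣ ℚ.< 1ℚ → x ℚ.≤ y ℚ.+ 1ℚ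
  below x y lt = begin
    x                   ≡⟨ ℚ.+-identityʳ x ⟨
    x ℚ.+ ℚ.0ℚ          ≡⟨ cong (x ℚ.+_) (ℚ.+-inverseˡ y) ⟨
    x ℚ.+ (ℚ.- y ℚ.+ y) ≡⟨ ℚ.+-assoc x (ℚ.- y) y ⟨
    x ℚ.- y ℚ.+ y       ≤⟨ ℚ.+-monoˡ-≤ y (ℚ.≤-trans (p≤∣p∣ (x ℚ.- y)) (ℚ.<⇒≤ lt)) ⟩
    1ℚ ℚ.+ y            ≡⟨ ℚ.+-comm 1ℚ y ⟩
    y ℚ.+ 1ℚ            ∎
    where open ℚ.≤-Reasoning

fromℕ-* : ∀ m n → + m / 1 ℚ.* (+ n / 1) ≡ + (m * n) / 1
fromℕ-* m n = ℚ.toℚᵘ-injective (begin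
  ℚ.toℚᵘ (+ m / 1 ℚ.* (+ n / 1)) ≈⟨ ℚ.toℚᵘ-homo-* (+ m / 1) (+ n / 1) ⟩
  ℚ.toℚᵘ (+ m / 1) ℚᵘ.* ℚ.toℚᵘ (+ n / 1) ≈⟨ ℚᵘ.*-cong (toℚᵘ-/ (+ m) 1) (toℚᵘ-/ (+ n) 1) ⟩
  (+ m ℚᵘ./ 1) ℚᵘ.* (+ n ℚᵘ./ 1) ≈⟨ ℚᵘ.*≡* (cong (ℤ._* + 1) (sym (ℤ.pos-* m n))) ⟩
  + (m * n) ℚᵘ./ 1 ≈⟨ toℚᵘ-/ (+ (m * n)) 1 ⟨
  ℚ.toℚᵘ (+ (m * n) / 1) ∎)
  where open ℚᵘ.≃-Reasoning

p≤p+ε : ∀ {ε} p → 0ℚ ℚ.< ε → p ℚ.≤ p ℚ.+ ε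
p≤p+ε {ε} p 0<ε = subst (ℚ._≤ p ℚ.+ ε) (ℚ.+-identityʳ p) (ℚ.+-monoʳ-≤ p (ℚ.<⇒≤ 0<ε))

≤ᴿ-refl : ∀ {x} → x ≤ᴿ x
≤ᴿ-refl {x} ε 0<ε = 0 , λ i _ → p≤p+ε (seq x i) 0<ε

·-≤ᴿ : ∀ c C m l {n₀} → (∀ i → n₀ ≤ i → seq c i ℚ.≤ + C / 1) → C * m ≤ l → c · m ≤ᴿ fromℕ l
·-≤ᴿ c C m l {n₀} c≤C Cm≤l ε 0<ε = n₀ , λ i n₀≤i → begin
  seq c i ℚ.* (+ m / 1)     ≤⟨ ℚ.*-monoʳ-≤-nonNeg (+ m / 1) {{ℚ.normalize-nonNeg m 1}} (c≤C i n₀≤i) ⟩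
  + C / 1 ℚ.* (+ m / 1)     ≡⟨ fromℕ-* C m ⟩
  + (C * m) / 1             ≤⟨ /-mono-≤ (+ (C * m)) (+ l) 1 1 (ℤ.*-monoʳ-≤-nonNeg (+ 1) (ℤ.+≤+ Cm≤l)) ⟩
  + l / 1                   ≤⟨ p≤p+ε (+ l / 1) 0<ε ⟩
  + l / 1 ℚ.+ ε             ∎
  where open ℚ.≤-Reasoning

-- Sparse sets of lines

-- Merging components along a new line sends a point to its old representative,
-- back to the new line, across it, and on to the common representative.
reach : ℕ → ℕ
reach zero    = 0
reach (suc t) = reach t + suc (reach t + reach t)

reach-mono : ∀ {t s} → t ≤ s → reach t ≤ reach s
reach-mono z≤n       = z≤n
reach-mono (s≤s t≤s) =
  ℕ.+-mono-≤ (reach-mono t≤s) (s≤s (ℕ.+-mono-≤ (reach-mono t≤s) (reach-mono t≤s)))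

module Incidence {a b : ℕ} (E : Fin a → Subset b) where

  open DecMembership (Fin._≟_ {b}) using () renaming (_∈?_ to _∈ᴸ?_)

  private
    variable
      i j : ℕ
      u : Fin a
      x y z : Fin b
      S Y : List (Fin a)

  Linear : Set
  Linear = ∀ {u u' x y} → x ≢ y → x ∈ E u → y ∈ E u → x ∈ E u' → y ∈ E u' → u ≡ u'

  -- Because of `stay`, the index is an upper bound for the number of lines used, and walks can be
  -- lengthened at will.
  data Walk (S : List (Fin a)) (x : Fin b) : ℕ → Fin b → Set where
    []   : Walk S x 0 x
    stay : Walk S x i y → Walk S x (suc i) y
    step : Walk S x i y → u List.∈ S → y ∈ E u → z ∈ E u → Walk S x (suc i) z

  trans-walk : Walk S x i y → Walk S y j z → Walk S x (j + i) z
  trans-walk w []              = w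
  trans-walk w (stay w')       = stay (trans-walk w w')
  trans-walk w (step w' u∈S p q) = step (trans-walk w w') u∈S p q

  resize : i ≡ j → Walk S x i y → Walk S x j y
  resize refl w = w

  sym-walk : Walk S x i y → Walk S y i x
  sym-walk [] = []
  sym-walk (stay w) = stay (sym-walk w)
  sym-walk (step {i} w u∈S p q) =
    resize (ℕ.+-comm i 1) (trans-walk (step [] u∈S q p) (sym-walk w))

  lengthen : i ≤ j → Walk S x i y → Walk S x j y
  lengthen i≤j w with ℕ.m≤n⇒∃[o]m+o≡n i≤j
  ... | k , refl = resize (ℕ.+-comm k _) (stays k w)
    where
    stays : ∀ k → Walk S x i y → Walk S x (k + i) y
    stays zero    w = w
    stays (suc k) w = stay (stays k w)

  weaken : Walk S x i y → Walk (u ∷ S) x i y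
  weaken []              = []
  weaken (stay w)        = stay (weaken w)
  weaken (step w u∈S p q) = step (weaken w) (there u∈S) p q

  degree : List (Fin a) → Fin b → ℕ
  degree S x = length (filter (λ u → x ∈? E u) S)

  record Admissible (H D : ℕ) (u : Fin a) (S : List (Fin a)) : Set where
    field
      fresh       : ¬ u List.∈ S
      separated   : x ∈ E u → y ∈ E u → x ≢ y → ¬ Walk S x H y
      unsaturated : x ∈ E u → degree S x < D

  -- The most recently inserted line comes first.
  data Sparse (H D : ℕ) : List (Fin a) → Set where
    []  : Sparse H D []
    _∷_ : Admissible H D u S → Sparse H D S → Sparse H D (u ∷ S)

  Covered : List (Fin a) → Fin b → Set
  Covered Y x = ∃[ u ] u List.∈ Y × x ∈ E u

  -- Every connected component of the lines of Y keeps one representative; merged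
  -- lists the points that have lost this status, e for each line of Y.
  record Merging (e : ℕ) (S Y : List (Fin a)) : Set where
    field
      rep            : Fin b → Fin b
      merged         : List (Fin b)
      rep∉merged     : ∀ x → ¬ rep x List.∈ merged
      merged-unique  : Unique merged
      merged-length  : length merged ≡ length Y * e
      merged-covered : x List.∈ merged → Covered Y x
      rep-covered    : ∀ x → rep x ≡ x ⊎ Covered Y (rep x)
      rep-near       : ∀ x → Walk S x (reach (length Y)) (rep x)

  module _ {H D e u S Y} (adm : Admissible H D u S) (M : Merging e S Y)
           (enough : reach (length Y) + reach (length Y) ≤ H) (size : ∣ E u ∣ ≡ suc e) where

    open Merging M
    open Admissible adm

    private
      split : ∃[ x ] ∃[ xs ] elements (E u) ≡ x ∷ xs × length xs ≡ e
      split = elements-nonempty (E u) size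

      p  = proj₁ split
      ps = proj₁ (proj₂ split)

      elements≡ : elements (E u) ≡ p ∷ ps
      elements≡ = proj₁ (proj₂ (proj₂ split))

      onLine : x List.∈ p ∷ ps → x ∈ E u
      onLine x∈ = ∈-elements⁻ (subst (_ List.∈_) (sym elements≡) x∈)

      unique : Unique (p ∷ ps)
      unique = subst Unique elements≡ (elements-unique (E u))

      -- A common representative would join the two points by a walk of length at most
      -- `reach (length Y) + reach (length Y) ≤ H`, which `separated` forbids.
      rep-injective : x List.∈ p ∷ ps → y List.∈ p ∷ ps → x ≢ y → rep x ≢ rep y
      rep-injective {x} {y} x∈ y∈ x≢y eq = separated (onLine x∈) (onLine y∈) x≢y
        (lengthen enough (trans-walk (rep-near x)
          (subst (λ r → Walk S r _ y) (sym eq) (sym-walk (rep-near y)))))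

      reps-unique : Unique (map rep (p ∷ ps))
      reps-unique = map-unique rep rep-injective unique

      touches? : ∀ r → Dec (r List.∈ map rep (p ∷ ps))
      touches? r = r ∈ᴸ? map rep (p ∷ ps)

      -- The component of the first point `p` absorbs every component that the new line meets. The
      -- decision is an argument so that the properties follow by cases on it.
      rep' : ∀ {r} → Dec (r List.∈ map rep (p ∷ ps)) → Fin b
      rep' (yes _)   = rep p
      rep' {r} (no _) = r

      merged' = map rep ps ++ merged

      cover : Covered Y x → Covered (u ∷ Y) x
      cover (v , v∈Y , x∈) = v , there v∈Y , x∈

      rep-on-line-covered : x List.∈ p ∷ ps → Covered (u ∷ Y) (rep x)
      rep-on-line-covered {x} x∈ with rep-covered x
      ... | inj₁ eq = u , here refl , subst (_∈ E u) (sym eq) (onLine x∈)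
      ... | inj₂ c  = cover c

      rep'∉merged' : ∀ {x} (t : Dec (rep x List.∈ map rep (p ∷ ps))) → ¬ rep' t List.∈ merged'
      rep'∉merged' {x} t r∈ with t | ∈-++⁻ (map rep ps) r∈
      ... | yes _ | inj₁ r∈ps = All¬⇒¬Any (AllPairs.head reps-unique) r∈ps
      ... | yes _ | inj₂ r∈M  = rep∉merged p r∈M
      ... | no ∉  | inj₁ r∈ps = ∉ (there r∈ps)
      ... | no ∉  | inj₂ r∈M  = rep∉merged x r∈M

      rep'-covered : ∀ {x} (t : Dec (rep x List.∈ map rep (p ∷ ps))) →
                     rep' t ≡ x ⊎ Covered (u ∷ Y) (rep' t)
      rep'-covered (yes _) = inj₂ (rep-on-line-covered (here refl))
      rep'-covered {x} (no _) with rep-covered x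
      ... | inj₁ eq = inj₁ eq
      ... | inj₂ c  = inj₂ (cover c)

      rep'-near : ∀ {x} (t : Dec (rep x List.∈ map rep (p ∷ ps))) →
                  Walk (u ∷ S) x (reach (suc (length Y))) (rep' t)
      rep'-near {x} (yes r∈) =
        let z , z∈ , eq = ∈-map⁻ rep r∈
            x⇝z = trans-walk (rep-near x) (subst (λ r → Walk S r _ z) (sym eq) (sym-walk (rep-near z)))
        in trans-walk (step (weaken x⇝z) (here refl) (onLine z∈) (onLine (here refl)))
                      (weaken (rep-near p))
      rep'-near {x} (no _) = lengthen (ℕ.m≤m+n _ _) (weaken (rep-near x))

    -- The `suc e` points of the line have distinct representatives; that of `p` survives and the
    -- other `e` become merged.
    merge-line : Merging e (u ∷ S) (u ∷ Y)
    merge-line = record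
      { rep            = λ x → rep' (touches? (rep x))
      ; merged         = merged'
      ; rep∉merged     = λ x → rep'∉merged' (touches? (rep x))
      ; merged-unique  = Unique.++⁺ (AllPairs.tail reps-unique) merged-unique
          λ (r∈ps , r∈M) → let z , _ , eq = ∈-map⁻ rep r∈ps in
            rep∉merged z (subst (List._∈ merged) eq r∈M)
      ; merged-length  = trans (length-++ (map rep ps))
          (cong₂ _+_ (trans (length-map rep ps) (proj₂ (proj₂ (proj₂ split)))) merged-length)
      ; merged-covered = λ x∈ → [ (λ r∈ps → let z , z∈ , eq = ∈-map⁻ rep r∈ps in
            subst (Covered (u ∷ Y)) (sym eq) (rep-on-line-covered (there z∈)))
          , (λ x∈M → cover (merged-covered x∈M)) ]′ (∈-++⁻ (map rep ps) x∈)
      ; rep-covered    = λ x → rep'-covered (touches? (rep x))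
      ; rep-near       = λ x → rep'-near (touches? (rep x))
      }

  -- A line of `S` outside `Y` changes no component; it only enlarges the list along which walks may
  -- run. The distance to a representative thus depends on `length Y` alone, and one `H` serves for
  -- every length of `S`.
  merging : ∀ {e s H D} → reach s + reach s ≤ H → Sparse H D S →
            All (λ u → ∣ E u ∣ ≡ suc e) S → Y ⊆ S → length Y ≤ s → Merging e S Y
  merging enough [] [] [] _ = record
    { rep            = λ x → x
    ; merged         = []
    ; rep∉merged     = λ _ ()
    ; merged-unique  = []
    ; merged-length  = refl
    ; merged-covered = λ ()
    ; rep-covered    = λ _ → inj₁ refl
    ; rep-near       = λ _ → []
    }
  merging enough (_ ∷ sparse) (_ ∷ sizes) (u ∷ʳ Y⊆S) ∣Y∣≤s =
    record { Merging M ; rep-near = λ x → weaken (Merging.rep-near M x) }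
    where M = merging enough sparse sizes Y⊆S ∣Y∣≤s
  merging enough (adm ∷ sparse) (size ∷ sizes) (refl ∷ Y⊆S) ∣Y∣<s =
    merge-line adm (merging enough sparse sizes Y⊆S ∣Y∣≤s)
      (ℕ.≤-trans (ℕ.+-mono-≤ (reach-mono ∣Y∣≤s) (reach-mono ∣Y∣≤s)) enough) size
    where ∣Y∣≤s = ℕ.<⇒≤ ∣Y∣<s

  -- The merged points account for `length Y * e` points of `P`. The representative of a point on
  -- the first line of `Y` is covered but not merged, which gives one more.
  sparse-expands : ∀ {e s H D} {P : Subset b} → reach s + reach s ≤ H → Sparse H D S →
                   All (λ u → ∣ E u ∣ ≡ suc e) S → Y ⊆ S → length Y ≤ s → 0 < length Y →
                   (∀ {x} → Covered Y x → x ∈ P) → length Y * e < ∣ P ∣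
  sparse-expands {Y = u ∷ Y} {e = e} {P = P} enough sparse sizes Y⊆S ∣Y∣≤s _ covers =
    subst (_≤ ∣ P ∣) (cong suc merged-length)
      (Unique⇒length≤∣∣ (¬Any⇒All¬ _ (rep∉merged p) ∷ merged-unique)
        λ { (here refl) → covers p-covered ; (there x∈) → covers (merged-covered x∈) })
    where
    open Merging (merging enough sparse sizes Y⊆S ∣Y∣≤s)
    size : ∣ E u ∣ ≡ suc e
    size = All.lookup sizes (Sublist.lookup Y⊆S (here refl))
    split = elements-nonempty (E u) size
    p = proj₁ split
    p∈ : p ∈ E u
    p∈ = ∈-elements⁻ (subst (p List.∈_) (sym (proj₁ (proj₂ (proj₂ split)))) (here refl))
    p-covered : Covered (u ∷ Y) (rep p)
    p-covered with rep-covered p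
    ... | inj₁ eq = u , here refl , subst (_∈ E u) (sym eq) p∈
    ... | inj₂ c  = c

-- The greedy choice of lines

module Greedy {a b : ℕ} (E : Fin a → Subset b) where

  open Incidence E
  open DecMembership (Fin._≟_ {a}) using () renaming (_∈?_ to _∈ᴸ?_)

  private
    variable
      i H D : ℕ
      u : Fin a
      x y z : Fin b
      S : List (Fin a)

  -- The point `x` itself is included to match `stay`. Repetitions are harmless, since lengths are
  -- only bounded from above.
  neighbours : List (Fin a) → Fin b → List (Fin b)
  neighbours S x = x ∷ concatMap (λ u → elements (E u)) (filter (λ u → x ∈? E u) S)

  ball : List (Fin a) → ℕ → Fin b → List (Fin b)
  ball S zero    x = x ∷ []
  ball S (suc i) x = concatMap (neighbours S) (ball S i x)

  walk⇒∈ball : Walk S x i y → y List.∈ ball S i x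
  walk⇒∈ball []       = here refl
  walk⇒∈ball {S} (stay w) = ∈-concatMap (neighbours S) (walk⇒∈ball w) (here refl)
  walk⇒∈ball {S} (step w u∈S y∈u z∈u) = ∈-concatMap (neighbours S) (walk⇒∈ball w)
    (there (∈-concatMap (λ u → elements (E u)) (∈-filter⁺ (λ u → _ ∈? E u) u∈S y∈u) (∈-elements⁺ z∈u)))

  degree-∈ : x ∈ E u → degree (u ∷ S) x ≡ suc (degree S x)
  degree-∈ x∈u = cong length (filter-accept (λ u → _ ∈? E u) x∈u)

  degree-∉ : ¬ x ∈ E u → degree (u ∷ S) x ≡ degree S x
  degree-∉ x∉u = cong length (filter-reject (λ u → _ ∈? E u) x∉u)

  -- The degree of `x` grows only when a line through `x` is inserted, and by `unsaturated` it was
  -- then still below `D`.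
  sparse⇒degree≤ : Sparse H D S → ∀ x → degree S x ≤ D
  sparse⇒degree≤ []           x = z≤n
  sparse⇒degree≤ {D = D} (_∷_ {u = u} {S = S} adm sparse) x = by-incidence (x ∈? E u)
    where
    by-incidence : Dec (x ∈ E u) → degree (u ∷ S) x ≤ D
    by-incidence (yes x∈u) = subst (_≤ D) (sym (degree-∈ x∈u)) (Admissible.unsaturated adm x∈u)
    by-incidence (no  x∉u) = subst (_≤ D) (sym (degree-∉ x∉u)) (sparse⇒degree≤ sparse x)

  module _ {d : ℕ} (size≤ : ∀ u → ∣ E u ∣ ≤ d) where

    length-line : ∀ u → length (elements (E u)) ≤ d
    length-line u = subst (_≤ d) (sym (length-elements (E u))) (size≤ u)

    length-ball : (∀ x → degree S x ≤ D) → ∀ i x → length (ball S i x) ≤ suc (D * d) ^ i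
    length-ball             deg zero    x = ℕ.≤-refl
    length-ball {S} {D} deg (suc i) x = begin
      length (concatMap (neighbours S) (ball S i x)) ≤⟨ length-concatMap-≤ length-neighbours (ball S i x) ⟩
      length (ball S i x) * k                        ≤⟨ ℕ.*-monoˡ-≤ k (length-ball deg i x) ⟩
      k ^ i * k                                      ≡⟨ ℕ.*-comm (k ^ i) k ⟩
      k ^ suc i                                      ∎
      where
      open ℕ.≤-Reasoning
      -- The point itself, and at most `D` lines with at most `d` points each.
      k = suc (D * d)
      length-neighbours : ∀ y → length (neighbours S y) ≤ k
      length-neighbours y = s≤s (ℕ.≤-trans (length-concatMap-≤ length-line (filter (λ u → y ∈? E u) S))
                                           (ℕ.*-monoˡ-≤ d (deg y)))

    -- Double counting of incidences: inserting a line raises by 1 the degrees of exactly those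
    -- entries of `zs` that lie on it, and these number at most `d`.
    sum-degree≤ : ∀ {zs} → Unique zs → ∀ S → sum (map (degree S) zs) ≤ length S * d
    sum-degree≤ {zs} !zs []      = ℕ.≤-reflexive (sum-zero zs)
      where
      sum-zero : ∀ zs → sum (map (degree []) zs) ≡ 0
      sum-zero []       = refl
      sum-zero (_ ∷ zs) = sum-zero zs
    sum-degree≤ {zs} !zs (u ∷ S) = subst (_≤ d + length S * d) (sym (sum-cons zs))
      (ℕ.+-mono-≤ (ℕ.≤-trans
         (Unique⇒length≤∣∣ (Unique.filter⁺ (_∈? E u) !zs) λ z∈ → proj₂ (∈-filter⁻ (_∈? E u) {xs = zs} z∈))
         (size≤ u))
      (sum-degree≤ !zs S))
      where
      sum-cons : ∀ zs → sum (map (degree (u ∷ S)) zs) ≡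
                        length (filter (_∈? E u) zs) + sum (map (degree S) zs)
      sum-cons []       = refl
      sum-cons (z ∷ zs) = by-incidence (z ∈? E u)
        where
        by-incidence : Dec (z ∈ E u) →
                       degree (u ∷ S) z + sum (map (degree (u ∷ S)) zs) ≡
                       length (filter (_∈? E u) (z ∷ zs)) + (degree S z + sum (map (degree S) zs))
        by-incidence (yes z∈) = begin
          degree (u ∷ S) z + sum (map (degree (u ∷ S)) zs)
            ≡⟨ cong₂ _+_ (degree-∈ {S = S} z∈) (sum-cons zs) ⟩
          suc (degree S z + (length (filter (_∈? E u) zs) + sum (map (degree S) zs)))
            ≡⟨ cong suc (x∙yz≈y∙xz ℕ.+-commutativeSemigroup (degree S z) (length (filter (_∈? E u) zs)) _) ⟩
          suc (length (filter (_∈? E u) zs)) + (degree S z + sum (map (degree S) zs))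
            ≡⟨ cong (λ l → length l + _) (filter-accept (_∈? E u) z∈) ⟨
          length (filter (_∈? E u) (z ∷ zs)) + (degree S z + sum (map (degree S) zs)) ∎
          where open ≡-Reasoning
        by-incidence (no z∉) = begin
          degree (u ∷ S) z + sum (map (degree (u ∷ S)) zs)
            ≡⟨ cong₂ _+_ (degree-∉ {S = S} z∉) (sum-cons zs) ⟩
          degree S z + (length (filter (_∈? E u) zs) + sum (map (degree S) zs))
            ≡⟨ x∙yz≈y∙xz ℕ.+-commutativeSemigroup (degree S z) (length (filter (_∈? E u) zs)) _ ⟩
          length (filter (_∈? E u) zs) + (degree S z + sum (map (degree S) zs))
            ≡⟨ cong (λ l → length l + _) (filter-reject (_∈? E u) z∉) ⟨
          length (filter (_∈? E u) (z ∷ zs)) + (degree S z + sum (map (degree S) zs)) ∎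
          where open ≡-Reasoning

  -- With `x ≢ y` required, the diagonal pairs that occur in balls and products exclude no line.
  On : Fin a → Fin b × Fin b → Set
  On u (x , y) = x ≢ y × x ∈ E u × y ∈ E u

  On? : ∀ u xy → Dec (On u xy)
  On? u (x , y) = ¬? (x Fin.≟ y) ×-dec (x ∈? E u ×-dec y ∈? E u)

  -- By linearity a pair of points excludes at most one line. If no line were free, each would be
  -- coded by itself in `S` or by a pair on it, and no code serves two lines; so there would be at
  -- most `length S + length pairs` lines.
  find-unblocked : Linear → ∀ {lines} → Unique lines → ∀ S pairs → length S + length pairs < length lines →
                   ∃[ u ] u List.∈ lines × ¬ u List.∈ S × ¬ Any (On u) pairs
  find-unblocked linear {lines} !lines S pairs few with
    Any.any? (λ u → ¬? (u ∈ᴸ? S) ×-dec ¬? (Any.any? (On? u) pairs)) lines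
  ... | yes free = List.find free
  ... | no none  = contradiction few (ℕ.≤⇒≯ (subst (length lines ≤_) length-codes
          (pigeonhole functional !lines (All.map encode (¬Any⇒All¬ lines none)))))
    where
    codes : List (Fin a ⊎ Fin b × Fin b)
    codes = map inj₁ S ++ map inj₂ pairs
    length-codes : length codes ≡ length S + length pairs
    length-codes = trans (length-++ (map inj₁ S))
      (cong₂ _+_ (length-map inj₁ S) (length-map inj₂ pairs))
    Code : Fin a → Fin a ⊎ Fin b × Fin b → Set
    Code u (inj₁ v)  = u ≡ v
    Code u (inj₂ xy) = On u xy
    functional : ∀ {u u' c} → Code u c → Code u' c → u ≡ u'
    functional {c = inj₁ _} refl refl = refl
    functional {c = inj₂ _} (x≢y , p , q) (_ , p' , q') = linear x≢y p q p' q'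
    encode : ∀ {u} → ¬ (¬ u List.∈ S × ¬ Any (On u) pairs) → Any (Code u) codes
    encode {u} ¬free with u ∈ᴸ? S | Any.any? (On? u) pairs
    ... | yes u∈S | _        = Any.++⁺ˡ (Any.map⁺ u∈S)
    ... | no _    | yes on   = Any.++⁺ʳ (map inj₁ S) (Any.map⁺ on)
    ... | no u∉S  | no ¬on   = contradiction (u∉S , ¬on) ¬free

  -- A line is determined by its first point together with any of the others.
  lines-bound : Linear → ∀ {lines points} → (∀ {u x} → x ∈ E u → x List.∈ points) →
                ∀ {e} → All (λ u → ∣ E u ∣ ≡ suc e) lines → Unique lines →
                length lines * e ≤ length points * length points
  lines-bound linear {lines} {points} on-points {e} sizes !lines = begin
    length lines * e                           ≤⟨ length-concatMap-≥ (All.map length-flags sizes) ⟩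
    length (concatMap flags lines)             ≤⟨ Unique⇒length≤ flags-unique flags⊆ ⟩
    length (cartesianProduct points points)    ≡⟨ length-cartesianProduct points points ⟩
    length points * length points              ∎
    where
    open ℕ.≤-Reasoning
    flagsOf : List (Fin b) → List (Fin b × Fin b)
    flagsOf []       = []
    flagsOf (x ∷ xs) = map (x ,_) xs
    flags : Fin a → List (Fin b × Fin b)
    flags u = flagsOf (elements (E u))
    length-flags : ∀ {u} → ∣ E u ∣ ≡ suc e → e ≤ length (flags u)
    length-flags {u} size with elements-nonempty (E u) size
    ... | x , xs , eq , len rewrite eq = ℕ.≤-reflexive (sym (trans (length-map (x ,_) xs) len))
    flagsOf-On : ∀ xs {xy} → Unique xs → xy List.∈ flagsOf xs →
                 proj₁ xy ≢ proj₂ xy × proj₁ xy List.∈ xs × proj₂ xy List.∈ xs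
    flagsOf-On (x ∷ xs) (x# ∷ _) xy∈ with ∈-map⁻ (x ,_) xy∈
    ... | y , y∈ , refl = All.lookup x# y∈ , here refl , there y∈
    flags-On : ∀ {u xy} → xy List.∈ flags u → On u xy
    flags-On {u} xy∈ with flagsOf-On (elements (E u)) (elements-unique (E u)) xy∈
    ... | x≢y , x∈ , y∈ = x≢y , ∈-elements⁻ x∈ , ∈-elements⁻ y∈
    flagsOf-unique : ∀ xs → Unique xs → Unique (flagsOf xs)
    flagsOf-unique []       _        = []
    flagsOf-unique (x ∷ xs) (_ ∷ !xs) = Unique.map⁺ (λ { refl → refl }) !xs
    flags-disjoint : ∀ {u u'} → u ≢ u' → Disjoint (flags u) (flags u')
    flags-disjoint {u} {u'} u≢u' (p , q) =
      let x≢y , x∈ , y∈ = flags-On {u} p ; _ , x∈' , y∈' = flags-On {u'} q in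
      u≢u' (linear x≢y x∈ y∈ x∈' y∈')
    flags-unique : Unique (concatMap flags lines)
    flags-unique = Unique.concat⁺
      (All.map⁺ (All.universal (λ u → flagsOf-unique (elements (E u)) (elements-unique (E u))) lines))
      (AllPairs.map⁺ (AllPairs.map flags-disjoint !lines))
    flags⊆ : ∀ {xy} → xy List.∈ concatMap flags lines → xy List.∈ cartesianProduct points points
    flags⊆ xy∈ with List.find (∈-concatMap⁻ flags {xs = lines} xy∈)
    ... | u , _ , xy∈u with flags-On {u} xy∈u
    ...   | _ , x∈ , y∈ = ∈-cartesianProduct⁺ (on-points x∈) (on-points y∈)

  module _ (points : List (Fin b)) where

    saturated : ℕ → List (Fin a) → List (Fin b)
    saturated D S = filter (λ x → D ℕ.≤? degree S x) points

    close : ℕ → List (Fin a) → List (Fin b × Fin b)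
    close H S = concatMap (λ x → map (x ,_) (ball S H x)) points

    -- A line through a saturated point x is excluded by the pair of x and any
    -- other point of that line.
    blocked : ℕ → ℕ → List (Fin a) → List (Fin b × Fin b)
    blocked H D S = close H S ++ cartesianProduct (saturated D S) points

    unblocked⇒admissible : (∀ {u x} → x ∈ E u → x List.∈ points) →
                           2 ≤ ∣ E u ∣ → ¬ u List.∈ S → ¬ Any (On u) (blocked H D S) →
                           Admissible H D u S
    unblocked⇒admissible {u} {S} {H} {D} on-points 2≤ u∉S unblocked = record
      { fresh       = u∉S
      ; separated   = λ {x} {y} x∈ y∈ x≢y w → exclude x≢y x∈ y∈
          (∈-++⁺ˡ (∈-concatMap (λ x → map (x ,_) (ball S H x)) (on-points x∈) (∈-map⁺ (x ,_) (walk⇒∈ball w))))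
      -- The line has at least two points, so a saturated `x` on it forms a blocked pair with some
      -- other point of the line.
      ; unsaturated = λ {x} x∈ → ℕ.≰⇒> λ D≤ → let y , y∈ , x≢y = another x in
          exclude x≢y x∈ y∈ (∈-++⁺ʳ (close H S)
            (∈-cartesianProduct⁺ (∈-filter⁺ (λ x → D ℕ.≤? degree S x) (on-points x∈) D≤) (on-points y∈)))
      }
      where
      exclude : x ≢ y → x ∈ E u → y ∈ E u → ¬ (x , y) List.∈ blocked H D S
      exclude x≢y x∈ y∈ xy∈ = unblocked (Any.map (λ { refl → x≢y , x∈ , y∈ }) xy∈)
      another : ∀ x → ∃[ y ] y ∈ E u × x ≢ y
      another x with elements (E u) in eq | elements-unique (E u)
                   | subst (2 ≤_) (sym (length-elements (E u))) 2≤
      ... | y ∷ z ∷ _ | (y≢z ∷ _) ∷ _ | _ with x Fin.≟ y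
      ...   | yes refl = z , ∈-elements⁻ (subst (z List.∈_) (sym eq) (there (here refl))) , y≢z
      ...   | no x≢y   = y , ∈-elements⁻ (subst (y List.∈_) (sym eq) (here refl)) , x≢y
      another x | _ ∷ [] | _ | s≤s ()

    length-blocked : ∀ {d} → (∀ u → ∣ E u ∣ ≤ d) → Sparse H D S →
                     length (blocked H D S) ≤
                     length points * suc (D * d) ^ H + length (saturated D S) * length points
    length-blocked {H} {D} {S} size≤ sparse = ℕ.≤-trans (ℕ.≤-reflexive (length-++ (close H S)))
      (ℕ.+-mono-≤
        (length-concatMap-≤ (λ x → ℕ.≤-trans (ℕ.≤-reflexive (length-map (x ,_) (ball S H x)))
          (length-ball size≤ (sparse⇒degree≤ sparse) H x)) points)
        (ℕ.≤-reflexive (length-cartesianProduct (saturated D S) points)))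

    -- Each saturated point contributes at least `D` to the degree sum bounded in `sum-degree≤`.
    length-saturated : ∀ {d} → (∀ u → ∣ E u ∣ ≤ d) → Unique points → ∀ D S →
                       length (saturated D S) * D ≤ length S * d
    length-saturated size≤ !points D S = ℕ.≤-trans
      (sum-≥ (degree S) (All.all-filter (λ x → D ℕ.≤? degree S x) points))
      (sum-degree≤ size≤ (Unique.filter⁺ (λ x → D ℕ.≤? degree S x) !points) S)

-- Bipartite graphs as line systems

private
  variable
    a b : ℕ

∈-N⁺ : (G : BipartiteGraph a b) {X : Subset a} → ∀ {u v} → u ∈ X → v ∈ Γ G u → v ∈ N G X
∈-N⁺ G {X} {u} u∈X v∈ =
  ∈-comprehension⁺ (λ v → Fin.any? λ u → u ∈? X ×-dec v ∈? Γ G u) (u , u∈X , v∈)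

∈-N⁻ : (G : BipartiteGraph a b) {X : Subset a} → ∀ {v} → v ∈ N G X → ∃[ u ] u ∈ X × v ∈ Γ G u
∈-N⁻ G {X} = ∈-comprehension⁻ (λ v → Fin.any? λ u → u ∈? X ×-dec v ∈? Γ G u)

-- The hypothesis is `∣ N A X ∣ ≥ (d - 1) ∣ X ∣ + 1` without subtraction. Dividing by `∣ X ∣ ≤ t`
-- gives a ratio of at least `(d - 1) + 1/∣ X ∣`, hence at least `(d - 1) + 1/t`, so one inequality
-- covers all `t ≤ s`.
optimalExpander : (A : BipartiteGraph a b) {d s : ℕ} → LeftRegular A d → s ≤ ∣ L A ∣ →
                  (∀ X → IsSmall A s X → d * ∣ X ∣ < ∣ N A X ∣ + ∣ X ∣) → OptimalExpander A d s
optimalExpander A {d} {s} regular s≤∣L∣ expands = record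
  { regular   = regular
  ; s≤∣L∣     = s≤∣L∣
  ; expansion = λ t t≤s → expansion t t≤s (ℕ.≤-trans t≤s s≤∣L∣)
  }
  where
  clear : ∀ t k n → k ≤ t → d * k < n + k → k * (d * t + 1) ≤ t * (n + k)
  clear t k n k≤t dk<n+k = begin
    k * (d * t + 1) ≡⟨ solve 3 (λ k d t → k :* (d :* t :+ con 1) := t :* (d :* k) :+ k) refl k d t ⟩
    t * (d * k) + k ≤⟨ ℕ.+-monoʳ-≤ (t * (d * k)) k≤t ⟩
    t * (d * k) + t ≡⟨ solve 2 (λ t x → t :* x :+ t := t :* (con 1 :+ x)) refl t (d * k) ⟩
    t * suc (d * k) ≤⟨ ℕ.*-monoʳ-≤ t dk<n+k ⟩
    t * (n + k)     ∎
    where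
    open ℕ.≤-Reasoning
    open ℕ.+-*-Solver
  expansion : ∀ t .{{_ : ℕ.NonZero t}} → t ≤ s → (t≤∣L∣ : t ≤ ∣ L A ∣) →
              (+ d / 1 ℚ.- ℚ.1ℚ) ℚ.+ + 1 / t ℚ.≤ α A t t≤∣L∣
  expansion t {{t≢0}} t≤s t≤∣L∣ with α-attained A t t≤∣L∣
  ... | (X , X⊆L , 0<∣X∣ , ∣X∣≤t) , α≡ = subst (_ ℚ.≤_) (sym α≡)
    (⇒expansion d t ∣ N A X ∣ ∣ X ∣ {{t≢0}} {{ℕ.>-nonZero 0<∣X∣}}
      (clear t ∣ X ∣ ∣ N A X ∣ ∣X∣≤t (expands X (X⊆L , 0<∣X∣ , ℕ.≤-trans ∣X∣≤t t≤s))))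

-- Expansion at `t = 2` gives a pair of lines at least `2d - 1` points, whereas two lines with two
-- common points cover at most `2d - 2`.
expander⇒linear : (G : BipartiteGraph a b) {d : ℕ} → OptimalExpander G d 2 → Incidence.Linear (Γ G)
expander⇒linear G {d} opt {u} {u'} {x} {y} x≢y x∈u y∈u x∈u' y∈u' with u Fin.≟ u'
... | yes u≡u' = u≡u'
... | no  u≢u' = contradiction impossible ℕ.1+n≰n
  where
  open OptimalExpander opt
  X : Subset _
  X = ⁅ u ⁆ ∪ ⁅ u' ⁆
  u∈L  = proj₁ (BipartiteGraph.edge G x∈u)
  u'∈L = proj₁ (BipartiteGraph.edge G x∈u')
  X⊆L : X ⊆ˢ L G
  X⊆L v∈ with x∈p∪q⁻ ⁅ u ⁆ ⁅ u' ⁆ v∈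
  ... | inj₁ v∈ = subst (_∈ L G) (sym (x∈⁅y⁆⇒x≡y u v∈)) u∈L
  ... | inj₂ v∈ = subst (_∈ L G) (sym (x∈⁅y⁆⇒x≡y u' v∈)) u'∈L
  ∣X∣≤2 : ∣ X ∣ ≤ 2
  ∣X∣≤2 = ℕ.≤-trans (ℕ.m≤m+n _ _) (ℕ.≤-reflexive (trans (∣∪∣+∣∩∣ ⁅ u ⁆ ⁅ u' ⁆)
    (cong₂ _+_ (∣⁅x⁆∣≡1 u) (∣⁅x⁆∣≡1 u'))))
  2≤∣X∣ : 2 ≤ ∣ X ∣
  2≤∣X∣ = Unique⇒length≤∣∣ ((u≢u' ∷ []) ∷ [] ∷ [])
    λ { (here refl) → x∈p∪q⁺ (inj₁ (x∈⁅x⁆ u)) ; (there (here refl)) → x∈p∪q⁺ (inj₂ (x∈⁅x⁆ u')) }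
  ∣X∣≡2 : ∣ X ∣ ≡ 2
  ∣X∣≡2 = ℕ.≤-antisym ∣X∣≤2 2≤∣X∣
  0<∣X∣ : 0 < ∣ X ∣
  0<∣X∣ = ℕ.<⇒≤ 2≤∣X∣
  expand : ∣ X ∣ * (d * 2 + 1) ≤ 2 * (∣ N G X ∣ + ∣ X ∣)
  expand = expansion⇒ d 2 ∣ N G X ∣ ∣ X ∣ {{_}} {{ℕ.>-nonZero 0<∣X∣}}
    (ℚ.≤-trans (expansion 2 ℕ.≤-refl) (α-minimal G 2 _ (X , X⊆L , 0<∣X∣ , ∣X∣≤2)))
  N⊆ : N G X ⊆ˢ Γ G u ∪ Γ G u'
  N⊆ v∈ with ∈-N⁻ G v∈
  ... | w , w∈X , v∈w with x∈p∪q⁻ ⁅ u ⁆ ⁅ u' ⁆ w∈X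
  ...   | inj₁ w∈ = x∈p∪q⁺ (inj₁ (subst (λ w → _ ∈ Γ G w) (x∈⁅y⁆⇒x≡y u w∈) v∈w))
  ...   | inj₂ w∈ = x∈p∪q⁺ (inj₂ (subst (λ w → _ ∈ Γ G w) (x∈⁅y⁆⇒x≡y u' w∈) v∈w))
  common : 2 ≤ ∣ Γ G u ∩ Γ G u' ∣
  common = Unique⇒length≤∣∣ ((x≢y ∷ []) ∷ [] ∷ [])
    λ { (here refl) → x∈p∩q⁺ (x∈u , x∈u') ; (there (here refl)) → x∈p∩q⁺ (y∈u , y∈u') }
  open ℕ.≤-Reasoning
  impossible : suc (d * 2) ≤ d * 2
  impossible = begin
    suc (d * 2)                                ≡⟨ ℕ.+-comm 1 (d * 2) ⟩
    d * 2 + 1                                  ≤⟨ ℕ.*-cancelˡ-≤ 2 (subst (λ k → k * (d * 2 + 1) ≤ 2 * (∣ N G X ∣ + k)) ∣X∣≡2 expand) ⟩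
    ∣ N G X ∣ + 2                              ≤⟨ ℕ.+-mono-≤ (p⊆q⇒∣p∣≤∣q∣ N⊆) common ⟩
    ∣ Γ G u ∪ Γ G u' ∣ + ∣ Γ G u ∩ Γ G u' ∣    ≡⟨ ∣∪∣+∣∩∣ (Γ G u) (Γ G u') ⟩
    ∣ Γ G u ∣ + ∣ Γ G u' ∣                     ≡⟨ cong₂ _+_ (regular u u∈L) (regular u' u'∈L) ⟩
    d + d                                      ≡⟨ cong (_+_ d) (ℕ.+-identityʳ d) ⟨
    2 * d                                      ≡⟨ ℕ.*-comm 2 d ⟩
    d * 2                                      ∎

size≤degree : (G : BipartiteGraph a b) {d : ℕ} → LeftRegular G d → ∀ u → ∣ Γ G u ∣ ≤ d
size≤degree G regular u with u ∈? L G
... | yes u∈L = ℕ.≤-reflexive (regular u u∈L)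
... | no  u∉L = ℕ.≤-trans (∣∣≤length {xs = []} λ v∈ → contradiction (proj₁ (BipartiteGraph.edge G v∈)) u∉L) z≤n

-- Restriction of a graph to chosen lines

module _ (G : BipartiteGraph a b) (S : List (Fin a)) where

  open DecMembership (Fin._≟_ {a}) using () renaming (_∈?_ to _∈ᴸ?_)

  -- The right part is kept whole, so the comparison of `c · ∣ R A ∣` with `c · m k` becomes
  -- reflexivity.
  restrict : BipartiteGraph a b
  restrict = record
    { L    = comprehension λ u → (u ∈ᴸ? S) ×-dec (u ∈? L G)
    ; R    = R G
    ; Γ    = λ u → comprehension λ v → (u ∈ᴸ? S) ×-dec (v ∈? Γ G u)
    ; edge = λ {u} v∈ → let u∈S , v∈Γ = ∈-comprehension⁻ (λ v → (u ∈ᴸ? S) ×-dec (v ∈? Γ G u)) v∈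
                            u∈L , v∈R = BipartiteGraph.edge G v∈Γ
                        in ∈-comprehension⁺ (λ u → (u ∈ᴸ? S) ×-dec (u ∈? L G)) (u∈S , u∈L) , v∈R
    }

  ∈-restrict-L⁻ : ∀ {u} → u ∈ L restrict → u List.∈ S × u ∈ L G
  ∈-restrict-L⁻ = ∈-comprehension⁻ λ u → (u ∈ᴸ? S) ×-dec (u ∈? L G)

  ∈-restrict-L⁺ : ∀ {u} → u List.∈ S → u ∈ L G → u ∈ L restrict
  ∈-restrict-L⁺ u∈S u∈L = ∈-comprehension⁺ (λ u → (u ∈ᴸ? S) ×-dec (u ∈? L G)) (u∈S , u∈L)

  ∈-restrict-Γ⁻ : ∀ {u v} → v ∈ Γ restrict u → u List.∈ S × v ∈ Γ G u
  ∈-restrict-Γ⁻ {u} = ∈-comprehension⁻ λ v → (u ∈ᴸ? S) ×-dec (v ∈? Γ G u)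

  ∈-restrict-Γ⁺ : ∀ {u v} → u List.∈ S → v ∈ Γ G u → v ∈ Γ restrict u
  ∈-restrict-Γ⁺ {u} u∈S v∈ = ∈-comprehension⁺ (λ v → (u ∈ᴸ? S) ×-dec (v ∈? Γ G u)) (u∈S , v∈)

  restrict-subgraph : Subgraph restrict G
  restrict-subgraph = record
    { L-⊆ = λ u∈ → proj₂ (∈-restrict-L⁻ u∈)
    ; R-⊆ = λ v∈ → v∈
    ; Γ-⊆ = λ u v∈ → proj₂ (∈-restrict-Γ⁻ {u} v∈)
    }

  restrict-regular : ∀ {d} → LeftRegular G d → LeftRegular restrict d
  restrict-regular regular u u∈ = let u∈S , u∈L = ∈-restrict-L⁻ u∈ in
    trans (ℕ.≤-antisym (p⊆q⇒∣p∣≤∣q∣ λ v∈ → proj₂ (∈-restrict-Γ⁻ {u} v∈))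
                       (p⊆q⇒∣p∣≤∣q∣ λ v∈ → ∈-restrict-Γ⁺ u∈S v∈))
          (regular u u∈L)

sparse⇒unique : ∀ {E : Fin a → Subset b} {H D S} → Incidence.Sparse E H D S → Unique S
sparse⇒unique Incidence.[]            = []
sparse⇒unique (adm Incidence.∷ sparse) =
  ¬Any⇒All¬ _ (Incidence.Admissible.fresh adm) ∷ sparse⇒unique sparse

module _ (G : BipartiteGraph a b) {e s H D : ℕ} {S : List (Fin a)} (regular : LeftRegular G (suc e))
         (enough : reach s + reach s ≤ H)
         (sparse : Incidence.Sparse (Γ G) H D S) (S⊆L : All (_∈ L G) S) where

  length≤∣L∣ : length S ≤ ∣ L (restrict G S) ∣
  length≤∣L∣ = Unique⇒length≤∣∣ (sparse⇒unique sparse) λ u∈ → ∈-restrict-L⁺ G S u∈ (All.lookup S⊆L u∈)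

  restrict-optimal : s ≤ length S → OptimalExpander (restrict G S) (suc e) s
  restrict-optimal s≤ = optimalExpander (restrict G S) (restrict-regular G S regular)
    (ℕ.≤-trans s≤ length≤∣L∣) expands
    where
    expands : ∀ X → IsSmall (restrict G S) s X → suc e * ∣ X ∣ < ∣ N (restrict G S) X ∣ + ∣ X ∣
    expands X (X⊆L , 0<∣X∣ , ∣X∣≤s) = begin-strict
      suc e * ∣ X ∣                    ≡⟨ cong (_+_ ∣ X ∣) (ℕ.*-comm e ∣ X ∣) ⟩
      ∣ X ∣ + ∣ X ∣ * e                <⟨ ℕ.+-monoʳ-< ∣ X ∣ (subst (λ k → k * e < ∣ N (restrict G S) X ∣) length≡
                                             (Incidence.sparse-expands (Γ G) enough sparse
                                               (All.map (λ u∈L → regular _ u∈L) S⊆L) (Sublist.filter-⊆ (_∈? X) S)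
                                               (ℕ.≤-trans (ℕ.≤-reflexive length≡) ∣X∣≤s)
                                               (subst (0 <_) (sym length≡) 0<∣X∣) covers)) ⟩
      ∣ X ∣ + ∣ N (restrict G S) X ∣  ≡⟨ ℕ.+-comm ∣ X ∣ _ ⟩
      ∣ N (restrict G S) X ∣ + ∣ X ∣  ∎
      where
      open ℕ.≤-Reasoning
      -- Filtering `S` lists `X` in the order of insertion, as the sublist argument of
      -- `sparse-expands` demands.
      Y : List _
      Y = filter (_∈? X) S
      length≡ : length Y ≡ ∣ X ∣
      length≡ = ℕ.≤-antisym
        (Unique⇒length≤∣∣ (Unique.filter⁺ (_∈? X) (sparse⇒unique sparse)) λ u∈ → proj₂ (∈-filter⁻ (_∈? X) {xs = S} u∈))
        (∣∣≤length λ u∈X → ∈-filter⁺ (_∈? X) (proj₁ (∈-restrict-L⁻ G S (X⊆L u∈X))) u∈X)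
      covers : ∀ {x} → Incidence.Covered (Γ G) Y x → x ∈ N (restrict G S) X
      covers (u , u∈Y , x∈u) = let u∈S , u∈X = ∈-filter⁻ (_∈? X) {xs = S} u∈Y in
        ∈-N⁺ (restrict G S) u∈X (∈-restrict-Γ⁺ G S u∈S x∈u)

-- Constants and counting for the greedy choice

-- With this degree bound, C m lines of at most B + 1 points saturate at most
-- m / 2B points.
saturation : ℕ → ℕ → ℕ
saturation B C = 2 * B * (C * suc B)

-- The bound of `length-ball` for degree `saturation B C` and lines of at most `B + 1` points; it
-- does not depend on the graph.
ballSize : ℕ → ℕ → ℕ → ℕ
ballSize B C H = suc (saturation B C * suc B) ^ H

-- Here `K` bounds the balls and `σ` counts the saturated points. If `n` were at most the left-hand
-- side, multiplying by `2B` would give `2m² ≤ 2B(C + K)m + 2Bσm`. The last term is at most `m²`,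
-- which leaves `m ≤ 2B(C + K)`.
room : ∀ B C K {m n l σ} .{{_ : ℕ.NonZero C}} → m * m ≤ B * n → 2 * B * (C + K) < m →
       l ≤ C * m → σ * saturation B C ≤ l * suc B → l + (m * K + σ * m) < n
room B C K {m} {n} {l} {σ} m²≤Bn large l≤Cm σD≤ = ℕ.≰⇒> λ n≤ →
  ℕ.<⇒≱ large (ℕ.*-cancelʳ-≤ m (2 * B * (C + K)) m {{ℕ.>-nonZero (ℕ.≤-<-trans z≤n large)}}
    (ℕ.+-cancelʳ-≤ (m * m) (m * m) (2 * B * (C + K) * m) (begin
      m * m + m * m                              ≤⟨ ℕ.+-mono-≤ m²≤Bn m²≤Bn ⟩
      B * n + B * n                              ≡⟨ solve 2 (λ B n → B :* n :+ B :* n := con 2 :* B :* n) refl B n ⟩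
      2 * B * n                                  ≤⟨ ℕ.*-monoʳ-≤ (2 * B) n≤ ⟩
      2 * B * (l + (m * K + σ * m))              ≤⟨ ℕ.*-monoʳ-≤ (2 * B) (ℕ.+-monoˡ-≤ (m * K + σ * m) l≤Cm) ⟩
      2 * B * (C * m + (m * K + σ * m))          ≡⟨ solve 5 (λ B C m K σ → con 2 :* B :* (C :* m :+ (m :* K :+ σ :* m))
                                                       := con 2 :* B :* (C :+ K) :* m :+ σ :* (con 2 :* B) :* m) refl B C m K σ ⟩
      2 * B * (C + K) * m + σ * (2 * B) * m      ≤⟨ ℕ.+-monoʳ-≤ (2 * B * (C + K) * m) (ℕ.*-monoˡ-≤ m few-saturated) ⟩
      2 * B * (C + K) * m + m * m                ∎)))
  where
  open ℕ.≤-Reasoning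
  open ℕ.+-*-Solver
  few-saturated : σ * (2 * B) ≤ m
  few-saturated = ℕ.*-cancelʳ-≤ (σ * (2 * B)) m (C * suc B) {{ℕ.m*n≢0 C (suc B)}} (begin
    σ * (2 * B) * (C * suc B) ≡⟨ ℕ.*-assoc σ (2 * B) (C * suc B) ⟩
    σ * saturation B C        ≤⟨ σD≤ ⟩
    l * suc B                 ≤⟨ ℕ.*-monoˡ-≤ (suc B) l≤Cm ⟩
    C * m * suc B             ≡⟨ solve 3 (λ C m B → C :* m :* B := m :* (C :* B)) refl C m (suc B) ⟩
    m * (C * suc B)           ∎)

module _ (G : BipartiteGraph a b) {e : ℕ} (opt : OptimalExpander G (suc (suc e)) 2)
         (B C H : ℕ) .{{_ : ℕ.NonZero B}} .{{_ : ℕ.NonZero C}}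
         (dense : ∣ R G ∣ * ∣ R G ∣ ≤ B * ∣ L G ∣)
         (large : 2 * B * (C + ballSize B C H) < ∣ R G ∣) where

  private
    open OptimalExpander opt using (regular; s≤∣L∣)
    lines  = elements (L G)
    points = elements (R G)
    !lines = elements-unique (L G)

    on-points : ∀ {u x} → x ∈ Γ G u → x List.∈ points
    on-points x∈ = ∈-elements⁺ (proj₂ (BipartiteGraph.edge G x∈))

    open Greedy (Γ G)
    open Incidence (Γ G) using (Sparse; []; _∷_)

    -- With `n` lines of `d` points, `lines-bound` gives `n (d - 1) ≤ m² ≤ B n`, and `n` is
    -- positive.
    degree≤ : suc (suc e) ≤ suc B
    degree≤ = s≤s (ℕ.*-cancelʳ-≤ (suc e) B ∣ L G ∣ {{ℕ.>-nonZero (ℕ.≤-trans (s≤s z≤n) s≤∣L∣)}} (begin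
      suc e * ∣ L G ∣        ≡⟨ ℕ.*-comm (suc e) ∣ L G ∣ ⟩
      ∣ L G ∣ * suc e        ≡⟨ cong (_* suc e) (length-elements (L G)) ⟨
      length lines * suc e   ≤⟨ lines-bound (expander⇒linear G opt) on-points
                                  (All.tabulate λ u∈ → regular _ (∈-elements⁻ u∈)) !lines ⟩
      length points * length points ≡⟨ cong₂ _*_ (length-elements (R G)) (length-elements (R G)) ⟩
      ∣ R G ∣ * ∣ R G ∣      ≤⟨ dense ⟩
      B * ∣ L G ∣            ∎))
      where open ℕ.≤-Reasoning

    sizes : ∀ u → ∣ Γ G u ∣ ≤ suc B
    sizes u = ℕ.≤-trans (size≤degree G regular u) degree≤

    D = saturation B C

  -- Before each insertion fewer than `C m` lines are chosen, so by `room` the chosen lines and the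
  -- blocked pairs together are fewer than all lines.
  greedy : ∀ l → l ≤ C * ∣ R G ∣ → ∃[ S ] Sparse H D S × All (_∈ L G) S × length S ≡ l
  greedy zero    _ = [] , [] , [] , refl
  greedy (suc l) l<Cm with greedy l (ℕ.<⇒≤ l<Cm)
  ... | S , sparse , S⊆L , refl =
    let u , u∈ , u∉S , free = find-unblocked (expander⇒linear G opt) !lines S pairs few
        u∈L = ∈-elements⁻ u∈
        adm = unblocked⇒admissible points on-points
                (subst (2 ≤_) (sym (regular u u∈L)) (s≤s (s≤s z≤n))) u∉S free
    in u ∷ S , adm ∷ sparse , u∈L ∷ S⊆L , refl
    where
    open ℕ.≤-Reasoning
    pairs = blocked points H D S
    sat = saturated points D S
    few : length S + length pairs < length lines
    few = begin-strict
      length S + length pairs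
        ≤⟨ ℕ.+-monoʳ-≤ (length S) (length-blocked points sizes sparse) ⟩
      length S + (length points * ballSize B C H + length sat * length points)
        ≡⟨ cong (λ m → length S + (m * ballSize B C H + length sat * m)) (length-elements (R G)) ⟩
      length S + (∣ R G ∣ * ballSize B C H + length sat * ∣ R G ∣)
        <⟨ room B C (ballSize B C H) {σ = length sat} dense large (ℕ.<⇒≤ l<Cm)
             (length-saturated points sizes (elements-unique (R G)) D S) ⟩
      ∣ L G ∣
        ≡⟨ length-elements (L G) ⟨
      length lines ∎

-- Subexpanders, with left degree at most one treated separately

degree≤1-optimal : (G : BipartiteGraph a b) {d s : ℕ} → d ≤ 1 → LeftRegular G d → s ≤ ∣ L G ∣ →
                   OptimalExpander G d s
degree≤1-optimal G {zero} _ regular s≤ =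
  optimalExpander G regular s≤ λ X (_ , 0<∣X∣ , _) → ℕ.≤-trans 0<∣X∣ (ℕ.m≤n+m ∣ X ∣ ∣ N G X ∣)
-- For `d = 1` the inequality asks only that `N G X` be nonempty.
degree≤1-optimal G {suc zero} _ regular s≤ = optimalExpander G regular s≤ λ X (X⊆L , 0<∣X∣ , _) →
  ℕ.≤-trans (s≤s (ℕ.≤-reflexive (ℕ.*-identityˡ ∣ X ∣))) (ℕ.+-monoˡ-≤ ∣ X ∣ (nonempty X X⊆L 0<∣X∣))
  where
  nonempty : ∀ X → X ⊆ˢ L G → 0 < ∣ X ∣ → 1 ≤ ∣ N G X ∣
  nonempty X X⊆L 0<∣X∣ with elements X in eq | subst (0 <_) (sym (length-elements X)) 0<∣X∣
  ... | u ∷ _ | _ = subst (_≤ ∣ N G X ∣) (regular u (X⊆L u∈X)) (p⊆q⇒∣p∣≤∣q∣ (∈-N⁺ G u∈X))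
    where
    u∈X : u ∈ X
    u∈X = ∈-elements⁻ (subst (u List.∈_) (sym eq) (here refl))
degree≤1-optimal G {suc (suc _)} (s≤s ())

-- The graph already has enough lines: `B C m ≤ 2B(C + K)m ≤ m² ≤ B n`, and `B` cancels. The number
-- `K` is arbitrary, to fit the hypothesis of `large-subexpander`.
self-subexpander :
  (G : BipartiteGraph a b) {d : ℕ} → d ≤ 1 → LeftRegular G d → (B C s K : ℕ)
  .{{_ : ℕ.NonZero B}} .{{_ : ℕ.NonZero C}} →
  ∣ R G ∣ * ∣ R G ∣ ≤ B * ∣ L G ∣ → 2 * B * (C + K) < ∣ R G ∣ → s ≤ ∣ R G ∣ →
  Σ[ A ∈ BipartiteGraph a b ]
    Subgraph A G × LeftRegular A d × (C * ∣ R G ∣ ≤ ∣ L A ∣ × R A ≡ R G) × OptimalExpander A d s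
self-subexpander G d≤1 regular B C s K dense large s≤m =
  G , record { L-⊆ = λ u∈ → u∈ ; R-⊆ = λ v∈ → v∈ ; Γ-⊆ = λ _ v∈ → v∈ } , regular
  , (many , refl) , degree≤1-optimal G d≤1 regular (ℕ.≤-trans s≤m (ℕ.≤-trans (ℕ.m≤n*m ∣ R G ∣ C) many))
  where
  open ℕ.≤-Reasoning
  many : C * ∣ R G ∣ ≤ ∣ L G ∣
  many = ℕ.*-cancelˡ-≤ B (begin
    B * (C * ∣ R G ∣)       ≡⟨ ℕ.*-assoc B C ∣ R G ∣ ⟨
    B * C * ∣ R G ∣         ≤⟨ ℕ.*-monoˡ-≤ ∣ R G ∣ (ℕ.*-mono-≤ (ℕ.m≤n*m B 2) (ℕ.m≤m+n C K)) ⟩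
    2 * B * (C + K) * ∣ R G ∣ ≤⟨ ℕ.*-monoˡ-≤ ∣ R G ∣ (ℕ.<⇒≤ large) ⟩
    ∣ R G ∣ * ∣ R G ∣       ≤⟨ dense ⟩
    B * ∣ L G ∣             ∎)

large-subexpander :
  (G : BipartiteGraph a b) {d : ℕ} → OptimalExpander G d 2 → (B C s : ℕ)
  .{{_ : ℕ.NonZero B}} .{{_ : ℕ.NonZero C}} →
  ∣ R G ∣ * ∣ R G ∣ ≤ B * ∣ L G ∣ →
  2 * B * (C + ballSize B C (reach s + reach s)) < ∣ R G ∣ → s ≤ ∣ R G ∣ →
  Σ[ A ∈ BipartiteGraph a b ]
    Subgraph A G × LeftRegular A d × (C * ∣ R G ∣ ≤ ∣ L A ∣ × R A ≡ R G) × OptimalExpander A d s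
large-subexpander G {suc (suc e)} opt B C s dense large s≤m =
  -- Two points with a common representative are joined through it by a walk of length at most
  -- `reach s + reach s`, as long as at most `s` lines are merged; this dictates `H`.
  let S , sparse , S⊆L , length≡ = greedy G opt B C (reach s + reach s) dense large (C * ∣ R G ∣) ℕ.≤-refl
      regular = OptimalExpander.regular opt
  in restrict G S , restrict-subgraph G S , restrict-regular G S regular
   , (subst (_≤ ∣ L (restrict G S) ∣) length≡ (length≤∣L∣ G {s = s} regular ℕ.≤-refl sparse S⊆L) , refl)
   , restrict-optimal G regular ℕ.≤-refl sparse S⊆L
       (ℕ.≤-trans (ℕ.≤-trans s≤m (ℕ.m≤n*m ∣ R G ∣ C)) (ℕ.≤-reflexive (sym length≡)))
large-subexpander G {zero}     opt B C s = self-subexpander G z≤n (OptimalExpander.regular opt) B C s _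
large-subexpander G {suc zero} opt B C s = self-subexpander G ℕ.≤-refl (OptimalExpander.regular opt) B C s _

theorem1p6 : (a b d : ℕ → ℕ)
    (G : (k : ℕ) → BipartiteGraph (a k) (b k))
    (opt : (k : ℕ) → OptimalExpander (G k) (d k) 2) →
    let n : ℕ → ℕ
        n k = ∣ L (G k) ∣
        m : ℕ → ℕ
        m k = ∣ R (G k) ∣
    in
    Bounded (λ k → _/_ (+ (m k ^ 2)) (n k) {{L-nonZero (opt k)}}) →
    TendsToInfinity m →
    (s : ℕ) → 3 ≤ s →
    (c : ℝ) → fromℕ 1 <ᴿ c →
    ∃[ k* ] ((k : ℕ) → k* ≤ k →
      Σ[ A ∈ BipartiteGraph (a k) (b k) ]
        Subgraph A (G k) ×
        LeftRegular A (d k) ×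
        (c · m k ≤ᴿ fromℕ ∣ L A ∣ × c · ∣ R A ∣ ≤ᴿ c · m k) ×
        OptimalExpander A (d k) s)
theorem1p6 a b d G opt (bound , bounded) m→∞ s _ c _ =
  let C-1 , _ , c≤C = eventually-bounded c
      B = suc (proj₁ (natural-bound bound))
      C = suc C-1
      -- The constants `B`, `C` and `s` are the same for all `k`, so one threshold serves the whole
      -- family. The successor makes the inequality for `m` strict, and the summand `s` below
      -- ensures `s ≤ m`.
      threshold = suc (2 * B * (C + ballSize B C (reach s + reach s)))
      k* , beyond = m→∞ (threshold + s)
  in k* , λ k k*≤k →
    let m = ∣ R (G k) ∣
        m-large = beyond k k*≤k
        -- `m ^ 2` unfolds to `m * (m * 1)`.
        dense = subst (_≤ B * ∣ L (G k) ∣) (cong (m *_) (ℕ.*-identityʳ m))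
                  (bounded⇒ (m ^ 2) ∣ L (G k) ∣ {{L-nonZero (opt k)}} (bounded k))
        A , A⊆G , regular , (Cm≤∣L∣ , R≡) , optimal = large-subexpander (G k) (opt k) B C s dense
          (ℕ.≤-trans (ℕ.m≤m+n threshold s) m-large) (ℕ.≤-trans (ℕ.m≤n+m s threshold) m-large)
    in A , A⊆G , regular
     , (·-≤ᴿ c C m ∣ L A ∣ c≤C Cm≤∣L∣ , subst (λ R → c · ∣ R ∣ ≤ᴿ c · m) (sym R≡) (≤ᴿ-refl {c · m}))
     , optimal
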